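{- (Embedding) If $\psi$ is an $\mathcal L_{\mathsf{ID}}$-sentence with $\mathsf{ID}_1\vdash\psi$, then for every nice operator $\mathcal H$ there are $m,n\in\mathbb N$ with $\mathcal H\vdash^{\Omega\cdot2+n}_{\Omega+m}\psi^+$, where $\Omega\cdot 2=\Omega+\Omega$.
   Context: $\mathsf{ID}_1$: formulas are in negation normal form; an operator form is a formula $\varphi(x,X)$ of arithmetic with an extra unary predicate $X$, with one free number variable and no subformula $\neg Xt$. $\mathcal L_{\mathsf{ID}}$ extends $\mathcal L_{\mathsf{PA}}$ by a predicate $I_\varphi$ for each operator form; $\mathsf{ID}_1$ is Peano arithmetic with equality and induction for all $\mathcal L_{\mathsf{ID}}$-formulas plus (F) $\forall x(\varphi(x,I_\varphi)\to I_\varphi x)$ and (L) $\forall x(\varphi(x,\psi)\to\psi(x))\to\forall x(I_\varphi x\to\psi(x))$ for all operator forms $\varphi$ and $\mathcal L_{\mathsf{ID}}$-formulas $\psi$ ($\varphi(x,\psi)$ replaces each $Xt$ by $\psi(t)$). Ordinal terms: The set $\vartheta(\varepsilon_{\Omega+1})$ of terms, a relation $\prec$ and finite sets $E(\alpha)$ are defined by simultaneous recursion on term length: Terms: $\Omega$; $\vartheta\alpha$ for each term $\alpha$; $\langle\alpha_0,\dots,\alpha_{n-1}\rangle$ ($n\ge0$) provided that if $n>1$ then $\alpha_{n-1}\preceq\dots\preceq\alpha_0$ ($\preceq$ is $\prec$ or syntactic equality), and if $n=1$ then $\alpha_0$ is not $\Omega$ or of the form $\vartheta\beta$. $E(\Omega)=\emptyset$,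 $E(\vartheta\alpha)=\{\vartheta\alpha\}$, $E(\langle\alpha_0,\dots\rangle)=\bigcup_iE(\alpha_i)$. $\alpha\prec\beta$ iff: (1) $\alpha=\Omega$, $\beta=\langle\beta_0,\dots,\beta_{n-1}\rangle$, $n>0$, $\Omega\preceq\beta_0$; or (2) $\alpha=\vartheta\alpha'$ and either $\beta=\Omega$, or $\beta=\langle\beta_0,\dots\rangle$ nonempty with $\alpha\preceq\beta_0$, or $\beta=\vartheta\beta'$ with $\alpha'\prec\beta'$ and $\gamma\prec\beta$ for all $\gamma\in E(\alpha')$, or $\beta=\vartheta\beta'$ with $\alpha\preceq\gamma$ for some $\gamma\in E(\beta')$; or (3) $\alpha=\langle\alpha_0,\dots,\alpha_{m-1}\rangle$ and either $\beta\in\{\Omega\}\cup\{\vartheta\beta'\}$ with ($m=0$ or $\alpha_0\prec\beta$), or $\beta=\langle\beta_0,\dots,\beta_{n-1}\rangle$ is lexicographically larger ($\alpha$ a proper initial segment of $\beta$, or first difference $\alpha_j\prec\beta_j$). Numerals: $n:=\langle0,\dots,0\rangle$ ($n$ entries, $0=\langle\rangle$), $\omega:=\langle 1\rangle$. Addition: identify $\Omega,\vartheta\alpha$ with $\langle\Omega\rangle,\langle\vartheta\alpha\rangle$ and set $\langle\alpha_0,\dots,\alpha_{m-1}\rangle+\langle\beta_0,\dots,\beta_{n-1}\rangle=\langle\alpha_0,\dots,\alpha_{k-1},\beta_0,\dots,\beta_{n-1}\rangle$ where $k$ is largest such that $\beta_0\preceq\alpha_{k-1}$ (all of $\alpha$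 if $n=0$; $k=0$ if no such); $\omega\cdot\Omega=\Omega$, $\omega\cdot\vartheta\alpha=\vartheta\alpha$, $\omega\cdot\langle\alpha_0,\dots\rangle=\langle1+\alpha_0,\dots\rangle$. Infinitary language: $\mathcal L^\Omega_{\mathsf{ID}}$ extends $\mathcal L_{\mathsf{PA}}$ by predicates $I^{\prec\alpha}_\varphi$ for each operator form $\varphi$ and term $\alpha\preceq\Omega$; $\psi^+$ replaces each $I_\varphi$ in an $\mathcal L_{\mathsf{ID}}$-formula by $I^{\prec\Omega}_\varphi$; $\varphi(t,I^{\prec\gamma}_\varphi)$ replaces $x$ by $t$ and $Xs$ by $I^{\prec\gamma}_\varphi s$. Each sentence is assigned a disjunction or conjunction: a false $\mathcal L_{\mathsf{PA}}$-literal $\simeq$ empty disjunction; $I^{\prec\alpha}_\varphi t\simeq\bigvee_{\gamma\prec\alpha}\varphi(t,I^{\prec\gamma}_\varphi)$; $\psi_0\lor\psi_1\simeq\bigvee_{i\prec2}\psi_i$; $\exists x\,\psi(x)\simeq\bigvee_{n\prec\omega}\psi(n)$; and $\neg\psi\simeq\bigwedge_{\gamma\prec\alpha}\neg\psi_\gamma$ whenever $\psi\simeq\bigvee_{\gamma\prec\alpha}\psi_\gamma$. Ranks: $\operatorname{rk}=0$ for $\mathcal L_{\mathsf{PA}}$-literals, $\operatorname{rk}(\pm I^{\prec\alpha}_\varphi t)=\omega\cdot\alpha$, $\operatorname{rk}(\psi_0\lor\psi_1)=\operatorname{rk}(\psi_0\land\psi_1)=\max(\operatorname{rk}\psi_0,\operatorname{rk}\psi_1)+1$,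 $\operatorname{rk}(\exists x\psi)=\operatorname{rk}(\forall x\psi)=\operatorname{rk}(\psi)+1$. $k(\psi)$ is the set of $\alpha$ such that $\psi$ contains a literal $I^{\prec\alpha}_\varphi t$ or $\neg I^{\prec\alpha}_\varphi t$; for a sequent (finite set of sentences) $k(\Gamma)=\bigcup_{\psi\in\Gamma}k(\psi)$. Operators: with $\mathcal P$ the powerset of $\vartheta(\varepsilon_{\Omega+1})$, a nice operator is $\mathcal H:\mathcal P\to\mathcal P$ with $X\subseteq\mathcal H(X)$, ($X\subseteq\mathcal H(Y)\Rightarrow\mathcal H(X)\subseteq\mathcal H(Y)$), and ($\alpha\in\mathcal H(X)\Leftrightarrow E(\alpha)\subseteq\mathcal H(X)$); $\mathcal H[Z](X):=\mathcal H(Z\cup X)$. Derivations: $\mathcal H\vdash^\alpha_\rho\Gamma$ is defined by recursion on $\alpha$: it holds iff $\{\alpha\}\cup k(\Gamma)\subseteq\mathcal H(\emptyset)$ and one of: ($\bigwedge$) some $\psi\simeq\bigwedge_{\gamma\prec\delta}\psi_\gamma$ in $\Gamma$ such that for every $\gamma\prec\delta$ there is $\alpha(\gamma)\prec\alpha$ with $\mathcal H[\{\gamma\}]\vdash^{\alpha(\gamma)}_\rho\Gamma\cup\{\psi_\gamma\}$; ($\bigvee$) some $\psi\simeq\bigvee_{\gamma\prec\delta}\psi_\gamma$ in $\Gamma$, some $\gamma\prec\delta$ with $\gamma\prec\alpha$ and $\gamma\in\mathcal H(\emptyset)$, and $\alpha'\prec\alpha$ with $\mathcal H\vdash^{\alpha'}_\rho\Gamma\cup\{\psi_\gamma\}$;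 (Cut) some sentence $\psi$ with $\operatorname{rk}(\psi)\prec\rho$ and $\alpha'\prec\alpha$ with $\mathcal H\vdash^{\alpha'}_\rho\Gamma\cup\{\psi\}$ and $\mathcal H\vdash^{\alpha'}_\rho\Gamma\cup\{\neg\psi\}$; (Fix) $\Omega\preceq\alpha$, some $I^{\prec\Omega}_\varphi t\in\Gamma$ and $\alpha'\prec\alpha$ with $\mathcal H\vdash^{\alpha'}_\rho\Gamma\cup\{\varphi(t,I^{\prec\Omega}_\varphi)\}$. A single sentence is identified with the one-element sequent. -}

module Defs where

open import Data.Nat using (ℕ; zero; suc; _≡ᵇ_) renaming (_+_ to _+ℕ_; _*_ to _*ℕ_)
open import Data.Fin using (Fin) renaming (zero to fz; suc to fs)
open import Data.Bool using (Bool; true; false; _∧_; _∨_; not; if_then_else_; T)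
open import Data.List using (List; []; _∷_; _++_; replicate; length; map)
open import Data.List.Membership.Propositional using (_∈_)
open import Data.Product using (Σ; _×_; _,_; proj₁; proj₂)
open import Data.Sum using (_⊎_)
open import Data.Unit using (⊤)
open import Data.Empty using (⊥)
open import Relation.Binary.PropositionalEquality using (_≡_)

-- Ordinal terms  ϑ(ε_{Ω+1})
-- Raw syntax; well-formedness ('wf') is a separate (decidable) predicate.

data OT : Set where
  Ω   : OT
  ϑ   : OT → OT
  ⟨_⟩ : List OT → OT

mutual
  eqO : OT → OT → Bool
  eqO Ω Ω = true
  eqO (ϑ a) (ϑ b) = eqO a b
  eqO ⟨ as ⟩ ⟨ bs ⟩ = eqL as bs
  eqO _ _ = false

  eqL : List OT → List OT → Bool
  eqL [] [] = true
  eqL (a ∷ as) (b ∷ bs) = eqO a b ∧ eqL as bs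
  eqL _ _ = false

mutual
  lt : OT → OT → Bool
  lt Ω ⟨ b ∷ _ ⟩ = le Ω b
  lt Ω _ = false
  lt (ϑ a) Ω = true
  lt (ϑ a) (ϑ b) = (lt a b ∧ allLt a (ϑ b)) ∨ someGe (ϑ a) b
  lt (ϑ a) ⟨ [] ⟩ = false
  lt (ϑ a) ⟨ b ∷ _ ⟩ = le (ϑ a) b
  lt ⟨ [] ⟩ Ω = true
  lt ⟨ a ∷ _ ⟩ Ω = lt a Ω
  lt ⟨ [] ⟩ (ϑ b) = true
  lt ⟨ a ∷ _ ⟩ (ϑ b) = lt a (ϑ b)
  lt ⟨ as ⟩ ⟨ bs ⟩ = ltL as bs

  ltL : List OT → List OT → Bool
  ltL [] [] = false
  ltL [] (_ ∷ _) = true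
  ltL (_ ∷ _) [] = false
  ltL (a ∷ as) (b ∷ bs) = lt a b ∨ (eqO a b ∧ ltL as bs)

  le : OT → OT → Bool
  le a b = lt a b ∨ eqO a b

  -- allLt a β : every γ ∈ E(a) satisfies γ ≺ β
  allLt : OT → OT → Bool
  allLt Ω β = true
  allLt (ϑ a) β = lt (ϑ a) β
  allLt ⟨ as ⟩ β = allLtL as β

  allLtL : List OT → OT → Bool
  allLtL [] β = true
  allLtL (a ∷ as) β = allLt a β ∧ allLtL as β

  -- someGe x b : x ⪯ γ for some γ ∈ E(b)
  someGe : OT → OT → Bool
  someGe x Ω = false
  someGe x (ϑ b) = le x (ϑ b)
  someGe x ⟨ bs ⟩ = someGeL x bs

  someGeL : OT → List OT → Bool
  someGeL x [] = false
  someGeL x (b ∷ bs) = someGe x b ∨ someGeL x bs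

_≺_ : OT → OT → Set
a ≺ b = T (lt a b)

_⪯_ : OT → OT → Set
a ⪯ b = T (le a b)

notΩϑ : OT → Bool
notΩϑ Ω = false
notΩϑ (ϑ _) = false
notΩϑ ⟨ _ ⟩ = true

mutual
  wf : OT → Bool
  wf Ω = true
  wf (ϑ a) = wf a
  wf ⟨ xs ⟩ = wfL xs

  wfL : List OT → Bool
  wfL [] = true
  wfL (a ∷ []) = wf a ∧ notΩϑ a
  wfL (a ∷ b ∷ r) = wf a ∧ le b a ∧ wfL2 b r

  wfL2 : OT → List OT → Bool
  wfL2 a [] = wf a
  wfL2 a (b ∷ r) = wf a ∧ le b a ∧ wfL2 b r

IsTerm : OT → Set
IsTerm a = T (wf a)

mutual
  E : OT → List OT
  E Ω = []
  E (ϑ a) = ϑ a ∷ []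
  E ⟨ xs ⟩ = EL xs

  EL : List OT → List OT
  EL [] = []
  EL (a ∷ as) = E a ++ EL as

nat : ℕ → OT
nat n = ⟨ replicate n ⟨ [] ⟩ ⟩

ω : OT
ω = ⟨ nat 1 ∷ [] ⟩

-- identification of Ω, ϑα with ⟨Ω⟩, ⟨ϑα⟩
toL : OT → List OT
toL Ω = Ω ∷ []
toL (ϑ a) = ϑ a ∷ []
toL ⟨ xs ⟩ = xs

fromL : List OT → OT
fromL (Ω ∷ []) = Ω
fromL (ϑ a ∷ []) = ϑ a
fromL xs = ⟨ xs ⟩

-- keep b as = ⟨a_0,…,a_{k-1}⟩ for the largest k with b ⪯ a_{k-1} (empty if none)
keep : OT → List OT → List OT
keep b [] = []
keep b (a ∷ as) with keep b as
... | [] = if le b a then a ∷ [] else []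
... | r@(_ ∷ _) = a ∷ r

addL : List OT → List OT → List OT
addL as [] = as
addL as (b ∷ bs) = keep b as ++ (b ∷ bs)

infixl 6 _+O_
_+O_ : OT → OT → OT
a +O b = fromL (addL (toL a) (toL b))

ω·_ : OT → OT
ω· Ω = Ω
ω· ϑ a = ϑ a
ω· ⟨ xs ⟩ = ⟨ map (λ a → nat 1 +O a) xs ⟩

maxO : OT → OT → OT
maxO a b = if lt a b then b else a

-- Arithmetic terms and formulas (negation normal form, de Bruijn variables)
-- L_PA: 0, S, +, ·, =.  Formulas are parametrised by a set P of extra
-- unary predicate symbols.

data Tm (n : ℕ) : Set where
  var  : Fin n → Tm n
  zer  : Tm n
  sc   : Tm n → Tm n
  _⊕_  : Tm n → Tm n → Tm n
  _⊗_  : Tm n → Tm n → Tm n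

data Fm (P : Set) (n : ℕ) : Set where
  eq  : Tm n → Tm n → Fm P n
  neq : Tm n → Tm n → Fm P n
  pos : P → Tm n → Fm P n
  neg : P → Tm n → Fm P n
  and : Fm P n → Fm P n → Fm P n
  or  : Fm P n → Fm P n → Fm P n
  all : Fm P (suc n) → Fm P n
  ex  : Fm P (suc n) → Fm P n

renT : ∀ {n m} → (Fin n → Fin m) → Tm n → Tm m
renT ρ (var i) = var (ρ i)
renT ρ zer = zer
renT ρ (sc t) = sc (renT ρ t)
renT ρ (s ⊕ t) = renT ρ s ⊕ renT ρ t
renT ρ (s ⊗ t) = renT ρ s ⊗ renT ρ t

substT : ∀ {n m} → (Fin n → Tm m) → Tm n → Tm m
substT σ (var i) = σ i
substT σ zer = zer
substT σ (sc t) = sc (substT σ t)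
substT σ (s ⊕ t) = substT σ s ⊕ substT σ t
substT σ (s ⊗ t) = substT σ s ⊗ substT σ t

liftS : ∀ {n m} → (Fin n → Tm m) → Fin (suc n) → Tm (suc m)
liftS σ fz = var fz
liftS σ (fs i) = renT fs (σ i)

substF : ∀ {P n m} → (Fin n → Tm m) → Fm P n → Fm P m
substF σ (eq s t) = eq (substT σ s) (substT σ t)
substF σ (neq s t) = neq (substT σ s) (substT σ t)
substF σ (pos p t) = pos p (substT σ t)
substF σ (neg p t) = neg p (substT σ t)
substF σ (and A B) = and (substF σ A) (substF σ B)
substF σ (or A B) = or (substF σ A) (substF σ B)
substF σ (all A) = all (substF (liftS σ) A)
substF σ (ex A) = ex (substF (liftS σ) A)

sg : ∀ {n} → Tm n → Fin (suc n) → Tm n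
sg t fz = t
sg t (fs i) = var i

_[_] : ∀ {P n} → Fm P (suc n) → Tm n → Fm P n
A [ t ] = substF (sg t) A

wk : ∀ {P n} → Fm P n → Fm P (suc n)
wk = substF (λ i → var (fs i))

negF : ∀ {P n} → Fm P n → Fm P n
negF (eq s t) = neq s t
negF (neq s t) = eq s t
negF (pos p t) = neg p t
negF (neg p t) = pos p t
negF (and A B) = or (negF A) (negF B)
negF (or A B) = and (negF A) (negF B)
negF (all A) = ex (negF A)
negF (ex A) = all (negF A)

mapP : ∀ {P Q n} → (P → Q) → Fm P n → Fm Q n
mapP f (eq s t) = eq s t
mapP f (neq s t) = neq s t
mapP f (pos p t) = pos (f p) t
mapP f (neg p t) = neg (f p) t
mapP f (and A B) = and (mapP f A) (mapP f B)
mapP f (or A B) = or (mapP f A) (mapP f B)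
mapP f (all A) = all (mapP f A)
mapP f (ex A) = ex (mapP f A)

-- inst A σ ψ : replace the variables of A by σ, and each atom  q t  by ψ q (t)
-- (a negative atom ¬ q t by ¬ ψ q (t)).  ψ q has one extra variable (var 0).
inst : ∀ {Q P k m} → Fm Q k → (Fin k → Tm m) → (Q → Fm P (suc m)) → Fm P m
inst (eq s t) σ ψ = eq (substT σ s) (substT σ t)
inst (neq s t) σ ψ = neq (substT σ s) (substT σ t)
inst (pos q t) σ ψ = ψ q [ substT σ t ]
inst (neg q t) σ ψ = negF (ψ q [ substT σ t ])
inst (and A B) σ ψ = and (inst A σ ψ) (inst B σ ψ)
inst (or A B) σ ψ = or (inst A σ ψ) (inst B σ ψ)
inst (all A) σ ψ = all (inst A (liftS σ) (λ q → substF (liftS (λ i → var (fs i))) (ψ q)))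
inst (ex A) σ ψ = ex (inst A (liftS σ) (λ q → substF (liftS (λ i → var (fs i))) (ψ q)))

noNeg : ∀ {n} → Fm ⊤ n → Bool
noNeg (neg _ _) = false
noNeg (and A B) = noNeg A ∧ noNeg B
noNeg (or A B) = noNeg A ∧ noNeg B
noNeg (all A) = noNeg A
noNeg (ex A) = noNeg A
noNeg _ = true

-- φ(x,X): arithmetic formula with extra predicate X (the unique element of ⊤),
-- free variables among x (= var 0), no subformula ¬Xt
OpForm : Set
OpForm = Σ (Fm ⊤ 1) (λ φ → T (noNeg φ))

-- L_ID-formulas with n free variables: predicate symbols I_φ
FmID : ℕ → Set
FmID = Fm OpForm

-- φ(x, ψ) with x := var 0, inside a context of n+1 variables, ψ ∈ FmID (suc n)
-- having var 0 as its distinguished variable and var (suc i) as parameters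
opInst : ∀ {n} → OpForm → FmID (suc n) → FmID (suc n)
opInst φ ψ = inst (proj₁ φ) (λ _ → var fz) (λ _ → substF (liftS (λ i → var (fs i))) ψ)

-- Non-logical axioms of ID_1 (open formulas; free variables are parameters)
data Ax {n : ℕ} : FmID n → Set where
  eqRefl : ∀ t → Ax (eq t t)
  eqSub  : ∀ (A : FmID (suc n)) s t → Ax (or (neq s t) (or (negF (A [ s ])) (A [ t ])))
  sucNz  : ∀ t → Ax (neq (sc t) zer)
  sucInj : ∀ s t → Ax (or (neq (sc s) (sc t)) (eq s t))
  add0   : ∀ s → Ax (eq (s ⊕ zer) s)
  addS   : ∀ s t → Ax (eq (s ⊕ sc t) (sc (s ⊕ t)))
  mul0   : ∀ s → Ax (eq (s ⊗ zer) zer)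
  mulS   : ∀ s t → Ax (eq (s ⊗ sc t) ((s ⊗ t) ⊕ s))
  ind    : ∀ (A : FmID (suc n)) →
           Ax (or (negF (A [ zer ]))
                  (or (ex (and A (negF (substF (λ { fz → sc (var fz) ; (fs i) → var (fs i) }) A))))
                      (all A)))
  axF    : ∀ (φ : OpForm) →
           Ax (all (or (negF (opInst φ (pos φ (var fz)))) (pos φ (var fz))))
  axL    : ∀ (φ : OpForm) (ψ : FmID (suc n)) →
           Ax (or (negF (all (or (negF (opInst φ ψ)) ψ)))
                  (all (or (neg φ (var fz)) ψ)))

data Lit {P : Set} {n : ℕ} : Fm P n → Set where
  litEq  : ∀ s t → Lit (eq s t)
  litNeq : ∀ s t → Lit (neq s t)
  litPos : ∀ p t → Lit (pos p t)
  litNeg : ∀ p t → Lit (neg p t)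

-- Tait-style one-sided sequent calculus for ID_1 (sequents as lists = finite sets)
data IDProof : (n : ℕ) → List (FmID n) → Set where
  axLog : ∀ {n Γ} (A : FmID n) → Lit A → A ∈ Γ → negF A ∈ Γ → IDProof n Γ
  axNL  : ∀ {n Γ} (A : FmID n) → Ax A → A ∈ Γ → IDProof n Γ
  andI  : ∀ {n Γ} (A B : FmID n) → and A B ∈ Γ →
          IDProof n (A ∷ Γ) → IDProof n (B ∷ Γ) → IDProof n Γ
  orI   : ∀ {n Γ} (A B : FmID n) → or A B ∈ Γ →
          IDProof n (A ∷ B ∷ Γ) → IDProof n Γ
  allI  : ∀ {n Γ} (A : FmID (suc n)) → all A ∈ Γ →
          IDProof (suc n) (A ∷ map wk Γ) → IDProof n Γ
  exI   : ∀ {n Γ} (A : FmID (suc n)) → ex A ∈ Γ → (t : Tm n) →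
          IDProof n (A [ t ] ∷ Γ) → IDProof n Γ
  cut   : ∀ {n Γ} (C : FmID n) →
          IDProof n (C ∷ Γ) → IDProof n (negF C ∷ Γ) → IDProof n Γ

ID₁⊢_ : FmID 0 → Set
ID₁⊢ ψ = IDProof 0 (ψ ∷ [])

-- The infinitary language L^Ω_ID : predicates I^{≺α}_φ, represented as (φ , α)

PΩ : Set
PΩ = OpForm × OT

Sent : Set
Sent = Fm PΩ 0

_⁺ : ∀ {n} → FmID n → Fm PΩ n
ψ ⁺ = mapP (λ φ → φ , Ω) ψ

numT : ℕ → Tm 0
numT zero = zer
numT (suc n) = sc (numT n)

⟦_⟧ : Tm 0 → ℕ
⟦ var () ⟧
⟦ zer ⟧ = 0
⟦ sc t ⟧ = suc ⟦ t ⟧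
⟦ s ⊕ t ⟧ = ⟦ s ⟧ +ℕ ⟦ t ⟧
⟦ s ⊗ t ⟧ = ⟦ s ⟧ *ℕ ⟦ t ⟧

opAt : OpForm → Tm 0 → OT → Sent
opAt φ t γ = inst (proj₁ φ) (λ _ → t) (λ _ → pos (φ , γ) (var fz))

data Kind : Set where
  disj conj : Kind

-- components indexed by γ ≺ 2 (i.e. γ ∈ {0,1}) and by γ ≺ ω (numerals)
two : Sent → Sent → OT → Sent
two A B ⟨ [] ⟩ = A
two A B _ = B

lenO : OT → ℕ
lenO ⟨ xs ⟩ = length xs
lenO _ = 0

-- ψ ≃ ⋁_{γ≺δ} ψ_γ  or  ψ ≃ ⋀_{γ≺δ} ψ_γ  :  (kind , δ , γ ↦ ψ_γ)
shape : Sent → Kind × OT × (OT → Sent)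
shape (eq s t) = (if ⟦ s ⟧ ≡ᵇ ⟦ t ⟧ then conj else disj) , nat 0 , (λ _ → eq s t)
shape (neq s t) = (if ⟦ s ⟧ ≡ᵇ ⟦ t ⟧ then disj else conj) , nat 0 , (λ _ → neq s t)
shape (pos (φ , α) t) = disj , α , (λ γ → opAt φ t γ)
shape (neg (φ , α) t) = conj , α , (λ γ → negF (opAt φ t γ))
shape (and A B) = conj , nat 2 , two A B
shape (or A B) = disj , nat 2 , two A B
shape (all A) = conj , ω , (λ γ → A [ numT (lenO γ) ])
shape (ex A) = disj , ω , (λ γ → A [ numT (lenO γ) ])

kind : Sent → Kind
kind ψ = proj₁ (shape ψ)

bound : Sent → OT
bound ψ = proj₁ (proj₂ (shape ψ))

comp : Sent → OT → Sent
comp ψ = proj₂ (proj₂ (shape ψ))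

rk : ∀ {n} → Fm PΩ n → OT
rk (eq _ _) = nat 0
rk (neq _ _) = nat 0
rk (pos (_ , α) _) = ω· α
rk (neg (_ , α) _) = ω· α
rk (and A B) = maxO (rk A) (rk B) +O nat 1
rk (or A B) = maxO (rk A) (rk B) +O nat 1
rk (all A) = rk A +O nat 1
rk (ex A) = rk A +O nat 1

kF : ∀ {n} → Fm PΩ n → List OT
kF (eq _ _) = []
kF (neq _ _) = []
kF (pos (_ , α) _) = α ∷ []
kF (neg (_ , α) _) = α ∷ []
kF (and A B) = kF A ++ kF B
kF (or A B) = kF A ++ kF B
kF (all A) = kF A
kF (ex A) = kF A

InLΩ : Sent → Set
InLΩ ψ = ∀ α → α ∈ kF ψ → IsTerm α × (α ⪯ Ω)

-- Operators.  Subsets of ϑ(ε_{Ω+1}) are predicates on OT; only their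
-- members that are terms matter (inclusion is taken over terms).

Subset : Set₁
Subset = OT → Set

_⊆_ : Subset → Subset → Set
X ⊆ Y = ∀ α → IsTerm α → X α → Y α

∅ : Subset
∅ _ = ⊥

Op : Set₁
Op = Subset → Subset

record Nice (H : Op) : Set₁ where
  field
    extensive : ∀ X → X ⊆ H X
    closure   : ∀ X Y → X ⊆ H Y → H X ⊆ H Y
    Eclosed   : ∀ X α → IsTerm α → (H X α → ∀ β → β ∈ E α → H X β)
                                 × ((∀ β → β ∈ E α → H X β) → H X α)

_[[_]] : Op → OT → Op
(H [[ γ ]]) X = H (λ β → β ≡ γ ⊎ X β)

KOK : Op → List Sent → Set
KOK H Γ = ∀ ψ → ψ ∈ Γ → ∀ α → α ∈ kF ψ → H ∅ α

data Der : Op → OT → OT → List Sent → Set₁ where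
  ⋀R   : ∀ {H α ρ Γ} → IsTerm α → H ∅ α → KOK H Γ →
         (ψ : Sent) → ψ ∈ Γ → kind ψ ≡ conj →
         (∀ γ → IsTerm γ → γ ≺ bound ψ →
            Σ OT (λ αγ → (αγ ≺ α) × Der (H [[ γ ]]) αγ ρ (comp ψ γ ∷ Γ))) →
         Der H α ρ Γ
  ⋁R   : ∀ {H α ρ Γ} → IsTerm α → H ∅ α → KOK H Γ →
         (ψ : Sent) → ψ ∈ Γ → kind ψ ≡ disj →
         (γ : OT) → IsTerm γ → γ ≺ bound ψ → γ ≺ α → H ∅ γ →
         (α' : OT) → α' ≺ α → Der H α' ρ (comp ψ γ ∷ Γ) →
         Der H α ρ Γ
  CutR : ∀ {H α ρ Γ} → IsTerm α → H ∅ α → KOK H Γ →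
         (ψ : Sent) → InLΩ ψ → rk ψ ≺ ρ →
         (α' : OT) → α' ≺ α → Der H α' ρ (ψ ∷ Γ) → Der H α' ρ (negF ψ ∷ Γ) →
         Der H α ρ Γ
  FixR : ∀ {H α ρ Γ} → IsTerm α → H ∅ α → KOK H Γ →
         Ω ⪯ α → (φ : OpForm) (t : Tm 0) → pos (φ , Ω) t ∈ Γ →
         (α' : OT) → α' ≺ α → Der H α' ρ (opAt φ t Ω ∷ Γ) →
         Der H α ρ Γ

{-# OPTIONS --safe #-}
module Submission where

-- The components of ¬ I^{≺Ω} t are indexed by all terms γ ≺ Ω, so the derivations of
-- I^{≺γ} t , ¬ I^{≺γ} t and of ¬ Prog(ψ) , ¬ I^{≺γ} t , ψ(t) are built by recursion along ≺,
-- which is therefore shown to be well founded on terms.  Let W be its accessible part.  The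
-- terms α with E(α) ⊆ W are accessible for ≺ restricted to them (closure of W under ⟨…⟩ suffices),
-- and induction on such α gives ϑα ∈ W; hence every term is accessible.
--
-- A finite proof is then translated rule by rule.  Identities A , ¬ A have height
-- Ω + k; ¬ Prog(ψ) , ¬ I^{≺γ} t , ψ(t) has height Ω + ω^(e γ) + k, where e is increasing with
-- e Ω = Ω, which gives (L) at Ω + Ω + k; and (F) is the rule Fix.  The ordinal inequalities
-- needed are read off the lexicographic order, so that general transitivity and linearity
-- of ≺ are never used.

open import Defs
open import Data.Bool using (true; false; _∧_; _∨_; if_then_else_; T)
open import Data.Empty using (⊥; ⊥-elim)
open import Data.Fin using (Fin) renaming (zero to fz; suc to fs)
open import Data.List using (List; []; _∷_; _++_; map; replicate)
open import Data.List.Membership.Propositional using (_∈_)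
open import Data.List.Membership.Propositional.Properties using (∈-++⁺ˡ; ∈-++⁺ʳ; ∈-++⁻; ∈-map⁻)
open import Data.List.Properties using (length-replicate)
open import Data.List.Relation.Unary.All as All using (All; []; _∷_)
open import Data.List.Relation.Unary.All.Properties using (++⁺; ++⁻ˡ; ++⁻ʳ)
open import Data.List.Relation.Unary.Any using (here; there)
open import Data.Nat using (ℕ; zero; suc; _≡ᵇ_; z≤n; s≤s; _≤_; _⊔_; _≟_) renaming (_+_ to _+ℕ_; _*_ to _*ℕ_)
open import Data.Nat.Properties using (≡⇒≡ᵇ; ≡ᵇ⇒≡; m⊔n≤o⇒m≤o; m⊔n≤o⇒n≤o; ≤-trans; ≤-refl; m≤n+m; n≤1+n)
open import Data.Nat.Properties using (+-identityʳ; +-suc; *-zeroʳ; *-suc; +-comm; suc-injective)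
open import Data.Product using (Σ; _×_; _,_; proj₁; proj₂)
open import Data.Sum using (_⊎_; inj₁; inj₂)
open import Data.Unit using (⊤; tt)
open import Induction.WellFounded using (Acc; acc)
open import Relation.Binary.PropositionalEquality using (_≡_; refl; sym; trans; cong; cong₂; subst)
open import Relation.Nullary using (¬_; yes; no)

-- Well-foundedness of ≺ on terms

∧-elim : ∀ x {y} → T (x ∧ y) → T x × T y
∧-elim true p = tt , p

∧-intro : ∀ x {y} → T x → T y → T (x ∧ y)
∧-intro true _ q = q

∨-elim : ∀ x {y} → T (x ∨ y) → T x ⊎ T y
∨-elim true  p = inj₁ p
∨-elim false p = inj₂ p

∨-introˡ : ∀ x {y} → T x → T (x ∨ y)
∨-introˡ true p = p

∨-introʳ : ∀ x {y} → T y → T (x ∨ y)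
∨-introʳ true  _ = tt
∨-introʳ false p = p

mutual
  eqO-sound : ∀ a b → T (eqO a b) → a ≡ b
  eqO-sound Ω Ω _ = refl
  eqO-sound (ϑ a) (ϑ b) p = cong ϑ (eqO-sound a b p)
  eqO-sound ⟨ as ⟩ ⟨ bs ⟩ p = cong ⟨_⟩ (eqL-sound as bs p)

  eqL-sound : ∀ as bs → T (eqL as bs) → as ≡ bs
  eqL-sound [] [] _ = refl
  eqL-sound (a ∷ as) (b ∷ bs) p =
    let q , r = ∧-elim (eqO a b) p in cong₂ _∷_ (eqO-sound a b q) (eqL-sound as bs r)

mutual
  eqO-refl : ∀ a → T (eqO a a)
  eqO-refl Ω = tt
  eqO-refl (ϑ a) = eqO-refl a
  eqO-refl ⟨ as ⟩ = eqL-refl as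

  eqL-refl : ∀ as → T (eqL as as)
  eqL-refl [] = tt
  eqL-refl (a ∷ as) = ∧-intro (eqO a a) (eqO-refl a) (eqL-refl as)

⪯-cases : ∀ a b → a ⪯ b → a ≺ b ⊎ a ≡ b
⪯-cases a b p with ∨-elim (lt a b) p
... | inj₁ q = inj₁ q
... | inj₂ q = inj₂ (eqO-sound a b q)

≺⇒⪯ : ∀ a b → a ≺ b → a ⪯ b
≺⇒⪯ a b = ∨-introˡ (lt a b)

⪯-refl : ∀ a → a ⪯ a
⪯-refl a = ∨-introʳ (lt a a) (eqO-refl a)

ltL-cases : ∀ a as b bs → T (ltL (a ∷ as) (b ∷ bs)) → a ≺ b ⊎ (a ≡ b × T (ltL as bs))
ltL-cases a as b bs p with ∨-elim (lt a b) p
... | inj₁ q = inj₁ q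
... | inj₂ q = let e , l = ∧-elim (eqO a b) q in inj₂ (eqO-sound a b e , l)

-- Unlike wfL, this admits the one-element lists ⟨Ω⟩ and ⟨ϑα⟩, so it is inherited by tails.
Desc : List OT → Set
Desc [] = ⊤
Desc (a ∷ as) = T (wfL2 a as)

wfL⇒Desc : ∀ as → T (wfL as) → Desc as
wfL⇒Desc [] _ = tt
wfL⇒Desc (a ∷ []) p = proj₁ (∧-elim (wf a) p)
wfL⇒Desc (a ∷ b ∷ as) p = p

Desc-head : ∀ a as → Desc (a ∷ as) → IsTerm a
Desc-head a [] p = p
Desc-head a (b ∷ as) p = proj₁ (∧-elim (wf a) p)

Desc-tail : ∀ a as → Desc (a ∷ as) → Desc as
Desc-tail a [] _ = tt
Desc-tail a (b ∷ as) p = proj₂ (∧-elim (le b a) (proj₂ (∧-elim (wf a) p)))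

Desc-next : ∀ a b as → Desc (a ∷ b ∷ as) → b ⪯ a
Desc-next a b as p = proj₁ (∧-elim (le b a) (proj₂ (∧-elim (wf a) p)))

-- Stated for `≺` restricted to a predicate `M` because it is used twice: with `M` trivial for `W`,
-- and with `M` = `EW` for the terms whose `E` lies in `W`. `M-list` passes from a list term to its
-- entries.
module Lexicographic (M : OT → Set) (M-list : ∀ as → M ⟨ as ⟩ → All M as) where

  _⊏_ : OT → OT → Set
  a ⊏ b = IsTerm a × M a × a ≺ b

  _⊏L_ : List OT → List OT → Set
  as ⊏L bs = Desc as × All M as × T (ltL as bs)

  Acc-⪯ : ∀ {a b} → Acc _⊏_ b → IsTerm a → M a → a ⪯ b → Acc _⊏_ a
  Acc-⪯ {a} {b} ac@(acc rs) t m p with ⪯-cases a b p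
  ... | inj₁ q = rs (t , m , q)
  ... | inj₂ refl = ac

  HeadAcc : List OT → Set
  HeadAcc [] = ⊤
  HeadAcc (a ∷ _) = Acc _⊏_ a

  acc-[] : Acc _⊏L_ []
  acc-[] = acc λ { {[]} (_ , _ , ()) ; {_ ∷ _} (_ , _ , ()) }

  module _ {a : OT} (ih : ∀ {b} → b ⊏ a → ∀ as → Desc (b ∷ as) → All M (b ∷ as) → Acc _⊏L_ (b ∷ as)) where

    -- Inner induction, on the accessibility of the tail: a list below `a ∷ as` is empty, has a
    -- smaller head, which `ih` covers, or has the same head and a smaller tail.
    acc-∷-tail : ∀ {as} → Acc _⊏L_ as → Acc _⊏L_ (a ∷ as)
    acc-∷-tail {as} (acc rs) = acc below
      where
      below : ∀ {bs} → bs ⊏L (a ∷ as) → Acc _⊏L_ bs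
      below {[]} _ = acc-[]
      below {b ∷ bs} (d , m ∷ ms , p) with ltL-cases b bs a as p
      ... | inj₁ q = ih (Desc-head b bs d , m , q) bs d (m ∷ ms)
      ... | inj₂ (refl , q) = acc-∷-tail (rs (Desc-tail b bs d , ms , q))

    -- Entries descend: the next entry is smaller than `a`, and `ih` applies, or equal to `a`, and
    -- recursion on the length makes the shorter tail accessible, which `acc-∷-tail` extends by `a`.
    acc-tail : ∀ as → Desc (a ∷ as) → All M as → Acc _⊏L_ as
    acc-tail [] _ _ = acc-[]
    acc-tail (b ∷ as) d (m ∷ ms) with ⪯-cases b a (Desc-next a b as d)
    ... | inj₁ q = ih (Desc-head b as d' , m , q) as d' (m ∷ ms)
      where d' = Desc-tail a (b ∷ as) d
    ... | inj₂ refl = acc-∷-tail (acc-tail as (Desc-tail a (b ∷ as) d) ms)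

  acc-∷ : ∀ {a} → Acc _⊏_ a → ∀ as → Desc (a ∷ as) → All M (a ∷ as) → Acc _⊏L_ (a ∷ as)
  acc-∷ (acc rs) as d (m ∷ ms) = acc-∷-tail ih (acc-tail ih as d ms)
    where
    ih : ∀ {b} → b ⊏ _ → ∀ bs → Desc (b ∷ bs) → All M (b ∷ bs) → Acc _⊏L_ (b ∷ bs)
    ih p = acc-∷ (rs p)

  -- A term `Ω` or `ϑ b` below a list is at most its head, which `HeadAcc` makes accessible. Smaller
  -- lists fall to the induction on the list order, since their heads are at most the old head.
  accL⇒acc : ∀ {as} → HeadAcc as → Acc _⊏L_ as → Acc _⊏_ ⟨ as ⟩
  accL⇒acc {as} h (acc rs) = acc (below as h rs)
    where
    below : ∀ as → HeadAcc as → (∀ {bs} → bs ⊏L as → Acc _⊏L_ bs) → ∀ {b} → b ⊏ ⟨ as ⟩ → Acc _⊏_ b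
    below [] h rs {Ω} (_ , _ , ())
    below [] h rs {ϑ b} (_ , _ , ())
    below (a ∷ as) h rs {Ω} (t , m , p) = Acc-⪯ h t m p
    below (a ∷ as) h rs {ϑ b} (t , m , p) = Acc-⪯ h t m p
    below as h rs {⟨ [] ⟩} (t , m , p) = accL⇒acc tt (rs (tt , [] , p))
    below [] h rs {⟨ b ∷ bs ⟩} (t , m , ())
    below (a ∷ as) h rs {⟨ b ∷ bs ⟩} (t , m , p) = accL⇒acc hb (rs (d , ms , p))
      where
      d : Desc (b ∷ bs)
      d = wfL⇒Desc (b ∷ bs) t
      ms : All M (b ∷ bs)
      ms = M-list (b ∷ bs) m
      b⪯a : b ≺ a ⊎ (b ≡ a × T (ltL bs as)) → b ⪯ a
      b⪯a (inj₁ q) = ≺⇒⪯ b a q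
      b⪯a (inj₂ (refl , _)) = ⪯-refl b
      hb : Acc _⊏_ b
      hb = Acc-⪯ h (Desc-head b bs d) (All.head ms) (b⪯a (ltL-cases b bs a as p))

  acc-⟨⟩ : ∀ as → Desc as → All M as → HeadAcc as → Acc _⊏_ ⟨ as ⟩
  acc-⟨⟩ [] _ _ h = accL⇒acc h acc-[]
  acc-⟨⟩ (a ∷ as) d ms h = accL⇒acc h (acc-∷ h as d ms)

everything : ∀ (as : List OT) → All (λ _ → ⊤) as
everything [] = []
everything (_ ∷ as) = tt ∷ everything as

open Lexicographic (λ _ → ⊤) (λ as _ → everything as)
  using () renaming (_⊏_ to _⊏⊤_; Acc-⪯ to W-⪯; acc-⟨⟩ to W-⟨⟩)

W : OT → Set
W = Acc _⊏⊤_

EW : OT → Set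
EW a = All W (E a)

EW-list : ∀ as → All W (EL as) → All EW as
EW-list [] _ = []
EW-list (a ∷ as) p = ++⁻ˡ (E a) p ∷ EW-list as (++⁻ʳ (E a) p)

module Collapse = Lexicographic EW EW-list
open Collapse using () renaming (_⊏_ to _⊏E_)

mutual
  W-someGe : ∀ x b → IsTerm x → T (someGe x b) → EW b → W x
  W-someGe x (ϑ b) t p (w ∷ []) = W-⪯ w t tt p
  W-someGe x ⟨ bs ⟩ t p ws = W-someGeL x bs t p ws

  W-someGeL : ∀ x bs → IsTerm x → T (someGeL x bs) → All W (EL bs) → W x
  W-someGeL x (b ∷ bs) t p ws with ∨-elim (someGe x b) p
  ... | inj₁ q = W-someGe x b t q (++⁻ˡ (E b) ws)
  ... | inj₂ q = W-someGeL x bs t q (++⁻ʳ (E b) ws)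

module _ {a : OT} (EWa : EW a) (ih : ∀ {b} → b ⊏E a → W (ϑ b)) where
  mutual
    -- For `ϑ b` with `b ≺ a`, the members of `E b` are subterms below `ϑ a`, hence in `W` by
    -- recursion, and `ih` applies. For `ϑ b` at most a member of `E a`, `EWa` applies. For a list
    -- it suffices to treat the head.
    W-below-ϑ : ∀ b → IsTerm b → b ≺ ϑ a → W b
    W-below-ϑ (ϑ b) t p with ∨-elim (lt b a ∧ allLt b (ϑ a)) p
    ... | inj₁ q = let l , r = ∧-elim (lt b a) q in ih (t , EW-below-ϑ b t r , l)
    ... | inj₂ q = W-someGe (ϑ b) a t q EWa
    W-below-ϑ ⟨ [] ⟩ t p = W-⟨⟩ [] tt [] tt
    W-below-ϑ ⟨ b ∷ bs ⟩ t p = W-⟨⟩ (b ∷ bs) d (everything (b ∷ bs)) (W-below-ϑ b (Desc-head b bs d) p)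
      where d = wfL⇒Desc (b ∷ bs) t

    EW-below-ϑ : ∀ b → IsTerm b → T (allLt b (ϑ a)) → EW b
    EW-below-ϑ Ω t p = []
    EW-below-ϑ (ϑ b) t p = W-below-ϑ (ϑ b) t p ∷ []
    EW-below-ϑ ⟨ bs ⟩ t p = EW-below-ϑL bs (wfL⇒Desc bs t) p

    EW-below-ϑL : ∀ bs → Desc bs → T (allLtL bs (ϑ a)) → All W (EL bs)
    EW-below-ϑL [] d p = []
    EW-below-ϑL (b ∷ bs) d p = let q , r = ∧-elim (allLt b (ϑ a)) p in
      ++⁺ (EW-below-ϑ b (Desc-head b bs d) q) (EW-below-ϑL bs (Desc-tail b bs d) r)

W-ϑ : ∀ {a} → Acc _⊏E_ a → EW a → W (ϑ a)
W-ϑ (acc rs) e = acc λ {b} (t , _ , p) → W-below-ϑ e (λ q → W-ϑ (rs q) (proj₁ (proj₂ q))) b t p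

W⇒accE : ∀ {a} → W a → Acc _⊏E_ a
W⇒accE (acc rs) = acc λ (t , _ , p) → W⇒accE (rs (t , tt , p))

-- Descending along heads ends at the empty list or at some `ϑ b`, which belongs to its own `E` and
-- so to `W` by hypothesis; closure under lists leads back up.
accE-≺Ω : ∀ b → IsTerm b → EW b → b ≺ Ω → Acc _⊏E_ b
accE-≺Ω (ϑ b) t (w ∷ []) p = W⇒accE w
accE-≺Ω ⟨ [] ⟩ t e p = Collapse.acc-⟨⟩ [] tt [] tt
accE-≺Ω ⟨ b ∷ bs ⟩ t e p =
  Collapse.acc-⟨⟩ (b ∷ bs) d es (accE-≺Ω b (Desc-head b bs d) (All.head es) p)
  where
  d = wfL⇒Desc (b ∷ bs) t
  es = EW-list (b ∷ bs) e

accE : ∀ a → IsTerm a → EW a → Acc _⊏E_ a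
accE Ω t e = acc λ {b} (t , e , p) → accE-≺Ω b t e p
accE (ϑ a) t (w ∷ []) = W⇒accE w
accE ⟨ [] ⟩ t e = Collapse.acc-⟨⟩ [] tt [] tt
accE ⟨ a ∷ as ⟩ t e = Collapse.acc-⟨⟩ (a ∷ as) d es (accE a (Desc-head a as d) (All.head es))
  where
  d = wfL⇒Desc (a ∷ as) t
  es = EW-list (a ∷ as) e

mutual
  EW-all : ∀ a → IsTerm a → EW a
  EW-all Ω t = []
  EW-all (ϑ a) t = W-ϑ (accE a t (EW-all a t)) (EW-all a t) ∷ []
  EW-all ⟨ as ⟩ t = EW-allL as (wfL⇒Desc as t)

  EW-allL : ∀ as → Desc as → All W (EL as)
  EW-allL [] d = []
  EW-allL (a ∷ as) d = ++⁺ (EW-all a (Desc-head a as d)) (EW-allL as (Desc-tail a as d))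

_<ᵗ_ : OT → OT → Set
a <ᵗ b = IsTerm a × a ≺ b

-- Every term satisfies `EW`, so the restriction in `_⊏E_` is vacuous and its accessibility
-- transfers.
<ᵗ-accessible : ∀ a → IsTerm a → Acc _<ᵗ_ a
<ᵗ-accessible a t = go (accE a t (EW-all a t))
  where
  go : ∀ {a} → Acc _⊏E_ a → Acc _<ᵗ_ a
  go (acc rs) = acc λ {b} (t , p) → go (rs (t , EW-all b t , p))

-- Heights of derivations

𝟎 : OT
𝟎 = ⟨ [] ⟩

⊀𝟎 : ∀ a → ¬ (a ≺ 𝟎)
⊀𝟎 Ω ()
⊀𝟎 (ϑ a) ()
⊀𝟎 ⟨ [] ⟩ ()
⊀𝟎 ⟨ _ ∷ _ ⟩ ()

𝟎⪯ : ∀ a → 𝟎 ⪯ a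
𝟎⪯ Ω = tt
𝟎⪯ (ϑ a) = tt
𝟎⪯ ⟨ [] ⟩ = tt
𝟎⪯ ⟨ _ ∷ _ ⟩ = tt

Ω⋠ : ∀ a → a ≺ Ω → ¬ (Ω ⪯ a)
Ω⋠ ⟨ a ∷ _ ⟩ p q with ∨-elim (le Ω a) q
... | inj₁ r = Ω⋠ a p r

≺Ω-trans : ∀ a b → a ≺ b → b ≺ Ω → a ≺ Ω
≺Ω-trans Ω ⟨ b ∷ _ ⟩ p q = ⊥-elim (Ω⋠ b q p)
≺Ω-trans (ϑ a) b p q = tt
≺Ω-trans ⟨ [] ⟩ b p q = tt
≺Ω-trans ⟨ a ∷ _ ⟩ (ϑ b) p q = ≺Ω-trans a (ϑ b) p tt
≺Ω-trans ⟨ a ∷ as ⟩ ⟨ b ∷ bs ⟩ p q with ltL-cases a as b bs p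
... | inj₁ r = ≺Ω-trans a b r q
... | inj₂ (refl , _) = q

≺⪯Ω-trans : ∀ a b → a ≺ b → b ⪯ Ω → a ≺ Ω
≺⪯Ω-trans a b p q with ⪯-cases b Ω q
... | inj₁ r = ≺Ω-trans a b p r
... | inj₂ refl = p

-- Heads at arbitrary depth are considered because comparing `⟨ a ∷ as ⟩` with a list headed by it
-- compares `a` with that head, where `a` sits one level deeper.
data HeadOf (a : OT) : OT → Set where
  head  : ∀ {as} → HeadOf a ⟨ a ∷ as ⟩
  below : ∀ {b bs} → HeadOf a b → HeadOf a ⟨ b ∷ bs ⟩

HeadOf-trans : ∀ {a as b} → HeadOf ⟨ a ∷ as ⟩ b → HeadOf a b
HeadOf-trans head = below head
HeadOf-trans (below h) = below (HeadOf-trans h)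

HeadOf⇒≺ : ∀ a {b} → HeadOf a b → a ≺ b
HeadOf⇒≺ Ω head = tt
HeadOf⇒≺ Ω (below {b} h) = ≺⇒⪯ Ω b (HeadOf⇒≺ Ω h)
HeadOf⇒≺ (ϑ a) head = ⪯-refl (ϑ a)
HeadOf⇒≺ (ϑ a) (below {b} h) = ≺⇒⪯ (ϑ a) b (HeadOf⇒≺ (ϑ a) h)
HeadOf⇒≺ ⟨ [] ⟩ head = tt
HeadOf⇒≺ ⟨ [] ⟩ (below h) = tt
HeadOf⇒≺ ⟨ a ∷ as ⟩ head = ∨-introˡ (lt a ⟨ a ∷ as ⟩) (HeadOf⇒≺ a head)
HeadOf⇒≺ ⟨ a ∷ as ⟩ (below {b} h) = ∨-introˡ (lt a b) (HeadOf⇒≺ a (HeadOf-trans h))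

-- e γ is nonzero, strictly increasing in γ ⪯ Ω, and e Ω = Ω.
e : OT → OT
e Ω = Ω
e a@(ϑ _) = ⟨ a ∷ 𝟎 ∷ [] ⟩
e a@(⟨ _ ⟩) = ⟨ a ∷ 𝟎 ∷ [] ⟩

data Base : Set where
  0Ω 1Ω : Base

-- lev 0Ω γ n = ω^(e γ) + (1 + n)  and  lev 1Ω γ n = Ω + ω^(e γ) + (1 + n).
-- The summand 1 keeps the lists from being singletons.
-- It is opaque so that γ and n can be inferred from lev s γ n.
opaque
  lev : Base → OT → ℕ → OT
  lev 0Ω γ n = ⟨ e γ ∷ replicate (suc n) 𝟎 ⟩
  lev 1Ω γ n = ⟨ Ω ∷ e γ ∷ replicate (suc n) 𝟎 ⟩

𝟎≺e : ∀ a → 𝟎 ≺ e a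
𝟎≺e Ω = tt
𝟎≺e (ϑ a) = tt
𝟎≺e ⟨ _ ⟩ = tt

e-mono : ∀ a b → a ≺ b → e a ≺ e b
e-mono Ω ⟨ bs ⟩ p = ∨-introˡ (lt Ω ⟨ bs ⟩) p
e-mono (ϑ a) Ω p = tt
e-mono (ϑ a) (ϑ b) p = ∨-introˡ (lt (ϑ a) (ϑ b)) p
e-mono (ϑ a) ⟨ bs ⟩ p = ∨-introˡ (lt (ϑ a) ⟨ bs ⟩) p
e-mono ⟨ as ⟩ Ω p = p
e-mono ⟨ as ⟩ (ϑ b) p = ∨-introˡ (lt ⟨ as ⟩ (ϑ b)) p
e-mono ⟨ as ⟩ ⟨ bs ⟩ p = ∨-introˡ (lt ⟨ as ⟩ ⟨ bs ⟩) p

-- The second entry `𝟎` is what makes this hold for `ϑ a`: the one-element list of `ϑ a` is not a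
-- term.
e-term : ∀ a → IsTerm a → IsTerm (e a)
e-term Ω t = tt
e-term (ϑ a) t = ∧-intro (wf a) t tt
e-term ⟨ as ⟩ t = ∧-intro (wfL as) t (∧-intro (le 𝟎 ⟨ as ⟩) (𝟎⪯ ⟨ as ⟩) tt)

e⪯Ω : ∀ a → a ⪯ Ω → e a ⪯ Ω
e⪯Ω Ω p = tt
e⪯Ω (ϑ a) p = tt
e⪯Ω ⟨ as ⟩ p with ⪯-cases ⟨ as ⟩ Ω p
... | inj₁ q = ≺⇒⪯ (e ⟨ as ⟩) Ω q

E-e : ∀ a {b} → b ∈ E (e a) → b ∈ E a
E-e Ω ()
E-e (ϑ a) p = p
E-e ⟨ as ⟩ p with ∈-++⁻ (EL as) p
... | inj₁ q = q

E-zeros : ∀ n {b} → ¬ (b ∈ EL (replicate n 𝟎))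
E-zeros (suc n) = E-zeros n

Desc-zeros : ∀ a n → IsTerm a → Desc (a ∷ replicate n 𝟎)
Desc-zeros a zero t = t
Desc-zeros a (suc n) t = ∧-intro (wf a) t (∧-intro (le 𝟎 a) (𝟎⪯ a) (Desc-zeros 𝟎 n tt))

nat≺⟨⟩ : ∀ k {a as} → 𝟎 ≺ a → nat k ≺ ⟨ a ∷ as ⟩
nat≺⟨⟩ zero p = tt
nat≺⟨⟩ (suc k) {a} p = ∨-introˡ (lt 𝟎 a) p

zeros-mono : ∀ {m n} → m ≤ n → T (ltL (replicate m 𝟎) (replicate (suc n) 𝟎))
zeros-mono z≤n = tt
zeros-mono (s≤s p) = zeros-mono p

opaque
  unfolding lev

  -- With `Eclosed`, this places the height `lev s a n` in every operator set that contains `a`.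
  E-lev : ∀ s a n {b} → b ∈ E (lev s a n) → b ∈ E a
  E-lev 0Ω a n p with ∈-++⁻ (E (e a)) p
  ... | inj₁ q = E-e a q
  ... | inj₂ q = ⊥-elim (E-zeros n q)
  E-lev 1Ω a n p = E-lev 0Ω a n p

  lev-term : ∀ s a n → IsTerm a → a ⪯ Ω → IsTerm (lev s a n)
  lev-term 0Ω a n t p = Desc-zeros (e a) (suc n) (e-term a t)
  lev-term 1Ω a n t p = ∧-intro (le (e a) Ω) (e⪯Ω a p) (lev-term 0Ω a n t p)

  nat≺lev : ∀ k s a n → nat k ≺ lev s a n
  nat≺lev k 0Ω a n = nat≺⟨⟩ k (𝟎≺e a)
  nat≺lev k 1Ω a n = nat≺⟨⟩ k tt

  lev-mono : ∀ s a b m n → a ≺ b → lev s a m ≺ lev s b n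
  lev-mono 0Ω a b m n p = ∨-introˡ (lt (e a) (e b)) (e-mono a b p)
  lev-mono 1Ω a b m n p = ∨-introˡ (lt (e a) (e b)) (e-mono a b p)

  lev-step : ∀ s a n → lev s a n ≺ lev s a (suc n)
  lev-step 0Ω a n = ∨-introʳ (lt (e a) (e a)) (∧-intro (eqO (e a) (e a)) (eqO-refl (e a)) (zeros-mono {n} ≤-refl))
  lev-step 1Ω a n = lev-step 0Ω a n

  -- Both lists begin with `Ω`, and their second entries are `𝟎` and `e a`. Hence Ω + 1 + m, for
  -- arbitrary `m`, lies below Ω + ω^(e a).
  levΩ≺lev : ∀ m a n → lev 0Ω Ω m ≺ lev 1Ω a n
  levΩ≺lev m a n = ∨-introˡ (lt 𝟎 (e a)) (𝟎≺e a)

  -- Serves the side condition of `⋁R` that the chosen index lies below the height. For the base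
  -- `0Ω` it holds because `a` is the head of the head `e a`.
  ≺lev : ∀ s a n → a ≺ Ω → a ≺ lev s a n
  ≺lev 0Ω (ϑ a) n p = HeadOf⇒≺ (ϑ a) {lev 0Ω (ϑ a) n} (below head)
  ≺lev 0Ω ⟨ as ⟩ n p = HeadOf⇒≺ ⟨ as ⟩ {lev 0Ω ⟨ as ⟩ n} (below head)
  ≺lev 1Ω (ϑ a) n p = tt
  ≺lev 1Ω ⟨ [] ⟩ n p = tt
  ≺lev 1Ω ⟨ a ∷ as ⟩ n p = ∨-introˡ (lt a Ω) p

  Ω⪯lev : ∀ n → Ω ⪯ lev 1Ω Ω n
  Ω⪯lev n = tt

  lev-Ω : ∀ n → lev 1Ω Ω n ≡ (Ω +O Ω) +O nat (suc n)
  lev-Ω n = refl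

-- Infinitary formulas

-- Formulas whose closed terms have been evaluated and whose quantifiers are infinitary.
data Tree : Set where
  eqT neqT   : ℕ → ℕ → Tree
  posT negT  : OpForm → OT → ℕ → Tree
  andT orT   : Tree → Tree → Tree
  allT exT   : (ℕ → Tree) → Tree

infix 4 _≈_
-- Infinite branchings are compared pointwise, in place of extensional equality of functions.
data _≈_ : Tree → Tree → Set where
  eq≈  : ∀ {m n} → eqT m n ≈ eqT m n
  neq≈ : ∀ {m n} → neqT m n ≈ neqT m n
  pos≈ : ∀ {φ α k} → posT φ α k ≈ posT φ α k
  neg≈ : ∀ {φ α k} → negT φ α k ≈ negT φ α k
  and≈ : ∀ {R S R′ S′} → R ≈ R′ → S ≈ S′ → andT R S ≈ andT R′ S′
  or≈  : ∀ {R S R′ S′} → R ≈ R′ → S ≈ S′ → orT R S ≈ orT R′ S′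
  all≈ : ∀ {f g} → (∀ k → f k ≈ g k) → allT f ≈ allT g
  ex≈  : ∀ {f g} → (∀ k → f k ≈ g k) → exT f ≈ exT g

≈-refl : ∀ {S} → S ≈ S
≈-refl {eqT _ _} = eq≈
≈-refl {neqT _ _} = neq≈
≈-refl {posT _ _ _} = pos≈
≈-refl {negT _ _ _} = neg≈
≈-refl {andT _ _} = and≈ ≈-refl ≈-refl
≈-refl {orT _ _} = or≈ ≈-refl ≈-refl
≈-refl {allT f} = all≈ (λ k → ≈-refl)
≈-refl {exT f} = ex≈ (λ k → ≈-refl)

≈-reflexive : ∀ {R S} → R ≡ S → R ≈ S
≈-reflexive refl = ≈-refl

≈-sym : ∀ {R S} → R ≈ S → S ≈ R
≈-sym eq≈ = eq≈
≈-sym neq≈ = neq≈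
≈-sym pos≈ = pos≈
≈-sym neg≈ = neg≈
≈-sym (and≈ p q) = and≈ (≈-sym p) (≈-sym q)
≈-sym (or≈ p q) = or≈ (≈-sym p) (≈-sym q)
≈-sym (all≈ f) = all≈ (λ k → ≈-sym (f k))
≈-sym (ex≈ f) = ex≈ (λ k → ≈-sym (f k))

≈-trans : ∀ {R S U} → R ≈ S → S ≈ U → R ≈ U
≈-trans eq≈ eq≈ = eq≈
≈-trans neq≈ neq≈ = neq≈
≈-trans pos≈ pos≈ = pos≈
≈-trans neg≈ neg≈ = neg≈
≈-trans (and≈ p q) (and≈ p′ q′) = and≈ (≈-trans p p′) (≈-trans q q′)
≈-trans (or≈ p q) (or≈ p′ q′) = or≈ (≈-trans p p′) (≈-trans q q′)
≈-trans (all≈ f) (all≈ g) = all≈ (λ k → ≈-trans (f k) (g k))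
≈-trans (ex≈ f) (ex≈ g) = ex≈ (λ k → ≈-trans (f k) (g k))

~_ : Tree → Tree
~ eqT m n = neqT m n
~ neqT m n = eqT m n
~ posT φ α k = negT φ α k
~ negT φ α k = posT φ α k
~ andT R S = orT (~ R) (~ S)
~ orT R S = andT (~ R) (~ S)
~ allT f = exT (λ k → ~ f k)
~ exT f = allT (λ k → ~ f k)

~-cong : ∀ {R S} → R ≈ S → ~ R ≈ ~ S
~-cong eq≈ = neq≈
~-cong neq≈ = eq≈
~-cong pos≈ = neg≈
~-cong neg≈ = pos≈
~-cong (and≈ p q) = or≈ (~-cong p) (~-cong q)
~-cong (or≈ p q) = and≈ (~-cong p) (~-cong q)
~-cong (all≈ f) = ex≈ (λ k → ~-cong (f k))
~-cong (ex≈ f) = all≈ (λ k → ~-cong (f k))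

~-invol : ∀ S → ~ ~ S ≈ S
~-invol (eqT _ _) = eq≈
~-invol (neqT _ _) = neq≈
~-invol (posT _ _ _) = pos≈
~-invol (negT _ _ _) = neg≈
~-invol (andT R S) = and≈ (~-invol R) (~-invol S)
~-invol (orT R S) = or≈ (~-invol R) (~-invol S)
~-invol (allT f) = all≈ (λ k → ~-invol (f k))
~-invol (exT f) = ex≈ (λ k → ~-invol (f k))

Env : ℕ → Set
Env n = Fin n → ℕ

infixr 5 _◂_
_◂_ : ∀ {n} → ℕ → Env n → Env (suc n)
(k ◂ v) fz = k
(k ◂ v) (fs i) = v i

ev : ∀ {n} → Env n → Tm n → ℕ
ev v (var i) = v i
ev v zer = 0
ev v (sc t) = suc (ev v t)
ev v (s ⊕ t) = ev v s +ℕ ev v t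
ev v (s ⊗ t) = ev v s *ℕ ev v t

ev-subst : ∀ {n m} (σ : Fin n → Tm m) {u : Env m} {v : Env n} → (∀ i → ev u (σ i) ≡ v i) →
           ∀ t → ev u (substT σ t) ≡ ev v t
ev-subst σ h (var i) = h i
ev-subst σ h zer = refl
ev-subst σ h (sc t) = cong suc (ev-subst σ h t)
ev-subst σ h (s ⊕ t) = cong₂ _+ℕ_ (ev-subst σ h s) (ev-subst σ h t)
ev-subst σ h (s ⊗ t) = cong₂ _*ℕ_ (ev-subst σ h s) (ev-subst σ h t)

ev-ren : ∀ {n m} (τ : Fin n → Fin m) {u : Env m} {v : Env n} → (∀ i → u (τ i) ≡ v i) →
         ∀ t → ev u (renT τ t) ≡ ev v t
ev-ren τ h (var i) = h i
ev-ren τ h zer = refl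
ev-ren τ h (sc t) = cong suc (ev-ren τ h t)
ev-ren τ h (s ⊕ t) = cong₂ _+ℕ_ (ev-ren τ h s) (ev-ren τ h t)
ev-ren τ h (s ⊗ t) = cong₂ _*ℕ_ (ev-ren τ h s) (ev-ren τ h t)

ev-closed : ∀ (v : Env 0) t → ev v t ≡ ⟦ t ⟧
ev-closed v zer = refl
ev-closed v (sc t) = cong suc (ev-closed v t)
ev-closed v (s ⊕ t) = cong₂ _+ℕ_ (ev-closed v s) (ev-closed v t)
ev-closed v (s ⊗ t) = cong₂ _*ℕ_ (ev-closed v s) (ev-closed v t)

ev-numT : ∀ (v : Env 0) k → ev v (numT k) ≡ k
ev-numT v zero = refl
ev-numT v (suc k) = cong suc (ev-numT v k)

ev-liftS : ∀ {n m} (σ : Fin n → Tm m) {u : Env m} {v : Env n} → (∀ i → ev u (σ i) ≡ v i) →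
           ∀ k i → ev (k ◂ u) (liftS σ i) ≡ (k ◂ v) i
ev-liftS σ h k fz = refl
ev-liftS σ h k (fs i) = trans (ev-ren fs (λ _ → refl) (σ i)) (h i)

ev-sg : ∀ {n} (u : Env n) t {k} → ev u t ≡ k → ∀ i → ev u (sg t i) ≡ (k ◂ u) i
ev-sg u t h fz = h
ev-sg u t h (fs i) = refl

-- `F` interprets predicate symbols as families of trees: as literals for sentences, or as the tree
-- of a formula ψ that takes the place of X in an operator form.
tr : ∀ {P n} → (P → ℕ → Tree) → Fm P n → Env n → Tree
tr F (eq s t) v = eqT (ev v s) (ev v t)
tr F (neq s t) v = neqT (ev v s) (ev v t)
tr F (pos p t) v = F p (ev v t)
tr F (neg p t) v = ~ F p (ev v t)
tr F (and A B) v = andT (tr F A v) (tr F B v)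
tr F (or A B) v = orT (tr F A v) (tr F B v)
tr F (all A) v = allT (λ k → tr F A (k ◂ v))
tr F (ex A) v = exT (λ k → tr F A (k ◂ v))

tr-subst : ∀ {P n m} (F : P → ℕ → Tree) (A : Fm P n) (σ : Fin n → Tm m) {u : Env m} {v : Env n} →
           (∀ i → ev u (σ i) ≡ v i) → tr F (substF σ A) u ≈ tr F A v
tr-subst F (eq s t) σ h = ≈-reflexive (cong₂ eqT (ev-subst σ h s) (ev-subst σ h t))
tr-subst F (neq s t) σ h = ≈-reflexive (cong₂ neqT (ev-subst σ h s) (ev-subst σ h t))
tr-subst F (pos p t) σ h = ≈-reflexive (cong (F p) (ev-subst σ h t))
tr-subst F (neg p t) σ h = ≈-reflexive (cong (λ k → ~ F p k) (ev-subst σ h t))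
tr-subst F (and A B) σ h = and≈ (tr-subst F A σ h) (tr-subst F B σ h)
tr-subst F (or A B) σ h = or≈ (tr-subst F A σ h) (tr-subst F B σ h)
tr-subst F (all A) σ h = all≈ (λ k → tr-subst F A (liftS σ) (ev-liftS σ h k))
tr-subst F (ex A) σ h = ex≈ (λ k → tr-subst F A (liftS σ) (ev-liftS σ h k))

tr-neg : ∀ {P n} (F : P → ℕ → Tree) (A : Fm P n) v → tr F (negF A) v ≈ ~ tr F A v
tr-neg F (eq s t) v = ≈-refl
tr-neg F (neq s t) v = ≈-refl
tr-neg F (pos p t) v = ≈-refl
tr-neg F (neg p t) v = ≈-sym (~-invol (F p (ev v t)))
tr-neg F (and A B) v = or≈ (tr-neg F A v) (tr-neg F B v)
tr-neg F (or A B) v = and≈ (tr-neg F A v) (tr-neg F B v)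
tr-neg F (all A) v = ex≈ (λ k → tr-neg F A (k ◂ v))
tr-neg F (ex A) v = all≈ (λ k → tr-neg F A (k ◂ v))

tr-mapP : ∀ {P Q n} (F : Q → ℕ → Tree) (f : P → Q) (A : Fm P n) v → tr F (mapP f A) v ≈ tr (λ p → F (f p)) A v
tr-mapP F f (eq s t) v = ≈-refl
tr-mapP F f (neq s t) v = ≈-refl
tr-mapP F f (pos p t) v = ≈-refl
tr-mapP F f (neg p t) v = ≈-refl
tr-mapP F f (and A B) v = and≈ (tr-mapP F f A v) (tr-mapP F f B v)
tr-mapP F f (or A B) v = or≈ (tr-mapP F f A v) (tr-mapP F f B v)
tr-mapP F f (all A) v = all≈ (λ k → tr-mapP F f A (k ◂ v))
tr-mapP F f (ex A) v = ex≈ (λ k → tr-mapP F f A (k ◂ v))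

-- Syntactic substitution of formulas for predicates becomes a change of interpretation, from `F` to
-- `G`.
tr-inst : ∀ {P Q k m} (F : P → ℕ → Tree) (G : Q → ℕ → Tree) (A : Fm Q k) (σ : Fin k → Tm m)
          (ψ : Q → Fm P (suc m)) {u : Env m} {v : Env k} → (∀ i → ev u (σ i) ≡ v i) →
          (∀ q j → tr F (ψ q) (j ◂ u) ≈ G q j) → tr F (inst A σ ψ) u ≈ tr G A v
tr-inst F G (eq s t) σ ψ h g = ≈-reflexive (cong₂ eqT (ev-subst σ h s) (ev-subst σ h t))
tr-inst F G (neq s t) σ ψ h g = ≈-reflexive (cong₂ neqT (ev-subst σ h s) (ev-subst σ h t))
tr-inst F G (pos q t) σ ψ h g = ≈-trans (tr-subst F (ψ q) _ (ev-sg _ _ (ev-subst σ h t))) (g q _)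
tr-inst F G (neg q t) σ ψ h g =
  ≈-trans (tr-neg F (ψ q [ substT σ t ]) _)
    (~-cong (≈-trans (tr-subst F (ψ q) _ (ev-sg _ _ (ev-subst σ h t))) (g q _)))
tr-inst F G (and A B) σ ψ h g = and≈ (tr-inst F G A σ ψ h g) (tr-inst F G B σ ψ h g)
tr-inst F G (or A B) σ ψ h g = or≈ (tr-inst F G A σ ψ h g) (tr-inst F G B σ ψ h g)
tr-inst F G (all A) σ ψ h g =
  all≈ (λ k → tr-inst F G A (liftS σ) _ (ev-liftS σ h k)
    (λ q j → ≈-trans (tr-subst F (ψ q) _ (ev-liftS _ (λ _ → refl) j)) (g q j)))
tr-inst F G (ex A) σ ψ h g =
  ex≈ (λ k → tr-inst F G A (liftS σ) _ (ev-liftS σ h k)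
    (λ q j → ≈-trans (tr-subst F (ψ q) _ (ev-liftS _ (λ _ → refl) j)) (g q j)))

ε : Env 0
ε ()

literal : PΩ → ℕ → Tree
literal p = posT (proj₁ p) (proj₂ p)

sentT : Sent → Tree
sentT C = tr literal C ε

opT : OpForm → OT → ℕ → Tree
opT φ γ k = tr (λ _ → posT φ γ) (proj₁ φ) (λ _ → k)

idT : ∀ {n} → FmID n → Env n → Tree
idT = tr (λ φ → posT φ Ω)

sentT-opAt : ∀ φ t γ → sentT (opAt φ t γ) ≈ opT φ γ (ev ε t)
sentT-opAt φ t γ = tr-inst _ _ (proj₁ φ) _ _ (λ _ → refl) (λ _ _ → ≈-refl)

sentT-instance : ∀ A k → sentT (A [ numT k ]) ≈ tr literal A (k ◂ ε)
sentT-instance A k = tr-subst _ A _ (ev-sg ε (numT k) (ev-numT ε k))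

kF-subst : ∀ {n m} (A : Fm PΩ n) (σ : Fin n → Tm m) → kF (substF σ A) ≡ kF A
kF-subst (eq _ _) σ = refl
kF-subst (neq _ _) σ = refl
kF-subst (pos _ _) σ = refl
kF-subst (neg _ _) σ = refl
kF-subst (and A B) σ = cong₂ _++_ (kF-subst A σ) (kF-subst B σ)
kF-subst (or A B) σ = cong₂ _++_ (kF-subst A σ) (kF-subst B σ)
kF-subst (all A) σ = kF-subst A (liftS σ)
kF-subst (ex A) σ = kF-subst A (liftS σ)

kF-neg : ∀ {n} (A : Fm PΩ n) → kF (negF A) ≡ kF A
kF-neg (eq _ _) = refl
kF-neg (neq _ _) = refl
kF-neg (pos _ _) = refl
kF-neg (neg _ _) = refl
kF-neg (and A B) = cong₂ _++_ (kF-neg A) (kF-neg B)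
kF-neg (or A B) = cong₂ _++_ (kF-neg A) (kF-neg B)
kF-neg (all A) = kF-neg A
kF-neg (ex A) = kF-neg A

kF-inst : ∀ {Q k m γ} (A : Fm Q k) (σ : Fin k → Tm m) (ψ : Q → Fm PΩ (suc m)) →
          (∀ q {α} → α ∈ kF (ψ q) → α ≡ γ) → ∀ {α} → α ∈ kF (inst A σ ψ) → α ≡ γ
kF-inst (pos q t) σ ψ h p = h q (subst (_ ∈_) (kF-subst (ψ q) _) p)
kF-inst (neg q t) σ ψ h p =
  h q (subst (_ ∈_) (trans (kF-neg (ψ q [ substT σ t ])) (kF-subst (ψ q) _)) p)
kF-inst (and A B) σ ψ h p with ∈-++⁻ (kF (inst A σ ψ)) p
... | inj₁ r = kF-inst A σ ψ h r
... | inj₂ r = kF-inst B σ ψ h r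
kF-inst (or A B) σ ψ h p with ∈-++⁻ (kF (inst A σ ψ)) p
... | inj₁ r = kF-inst A σ ψ h r
... | inj₂ r = kF-inst B σ ψ h r
kF-inst (all A) σ ψ h p =
  kF-inst A (liftS σ) _ (λ q r → h q (subst (_ ∈_) (kF-subst (ψ q) _) r)) p
kF-inst (ex A) σ ψ h p =
  kF-inst A (liftS σ) _ (λ q r → h q (subst (_ ∈_) (kF-subst (ψ q) _) r)) p

kF-opAt : ∀ φ t γ {α} → α ∈ kF (opAt φ t γ) → α ≡ γ
kF-opAt φ t γ = kF-inst (proj₁ φ) (λ _ → t) _ (λ { _ (here refl) → refl })

kF-⁺ : ∀ {n} (A : FmID n) {α} → α ∈ kF (A ⁺) → α ≡ Ω
kF-⁺ (pos _ _) (here refl) = refl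
kF-⁺ (neg _ _) (here refl) = refl
kF-⁺ (and A B) p with ∈-++⁻ (kF (A ⁺)) p
... | inj₁ q = kF-⁺ A q
... | inj₂ q = kF-⁺ B q
kF-⁺ (or A B) p with ∈-++⁻ (kF (A ⁺)) p
... | inj₁ q = kF-⁺ A q
... | inj₂ q = kF-⁺ B q
kF-⁺ (all A) p = kF-⁺ A p
kF-⁺ (ex A) p = kF-⁺ A p

-- Derived rules

Nice-[[]] : ∀ {H} → Nice H → ∀ γ → Nice (H [[ γ ]])
Nice-[[]] N γ = record
  { extensive = λ X α t x → extensive _ α t (inj₂ x)
  ; closure = λ X Y X⊆ → closure _ _ λ where
      α t (inj₁ refl) → extensive _ α t (inj₁ refl)
      α t (inj₂ x) → X⊆ α t x
  ; Eclosed = λ X → Eclosed _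
  }
  where open Nice N

In : Op → OT → Set
In H α = IsTerm α × H ∅ α

In-[[]] : ∀ {H} → Nice H → ∀ γ {α} → In H α → In (H [[ γ ]]) α
In-[[]] N γ (t , h) = t , Nice.closure N ∅ _ (λ _ _ ()) _ t h

self-[[]] : ∀ {H} → Nice H → ∀ {γ} → IsTerm γ → In (H [[ γ ]]) γ
self-[[]] N t = t , Nice.extensive N _ _ t (inj₁ refl)

In-E : ∀ {H α β} → Nice H → IsTerm β → (∀ {δ} → δ ∈ E β → δ ∈ E α) → In H α → In H β
In-E N t sub (tα , h) =
  t , proj₂ (Nice.Eclosed N ∅ _ t) (λ δ p → proj₁ (Nice.Eclosed N ∅ _ tα) h δ (sub p))

In-∅E : ∀ {H β} → Nice H → IsTerm β → (∀ {δ} → ¬ (δ ∈ E β)) → In H β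
In-∅E N t none = t , proj₂ (Nice.Eclosed N ∅ _ t) (λ δ p → ⊥-elim (none p))

In-nat : ∀ {H} → Nice H → ∀ k → In H (nat k)
In-nat N k = In-∅E N (nat-term k) (E-zeros k)
  where
  nat-term : ∀ k → IsTerm (nat k)
  nat-term zero = tt
  nat-term (suc zero) = tt
  nat-term (suc (suc k)) = Desc-zeros 𝟎 (suc k) tt

-- Statements about derivability quantify over all larger worlds, which replaces weakening of
-- sequents and monotonicity in the operator.
record World : Set₁ where
  field
    op         : Op
    nice       : Nice op
    seq        : List Sent
    controlled : ∀ {C α} → C ∈ seq → α ∈ kF C → In op α

open World

infix 4 _∋_ _≼_
-- Membership up to the values of closed terms: exI produces A(t), but ⋁ only A(n).
record _∋_ (w : World) (S : Tree) : Set where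
  constructor via
  field
    sentence : Sent
    member   : sentence ∈ seq w
    matches  : sentT sentence ≈ S

∋-≈ : ∀ {w R S} → R ≈ S → w ∋ R → w ∋ S
∋-≈ p (via C m q) = via C m (≈-trans q p)

record _≼_ (w w′ : World) : Set where
  field
    In-≼ : ∀ {α} → In (op w) α → In (op w′) α
    ∋-≼  : ∀ {S} → w ∋ S → w′ ∋ S

open _≼_

≼-refl : ∀ {w} → w ≼ w
≼-refl = record { In-≼ = λ x → x ; ∋-≼ = λ x → x }

≼-trans : ∀ {u v w} → u ≼ v → v ≼ w → u ≼ w
≼-trans p q = record { In-≼ = λ x → In-≼ q (In-≼ p x) ; ∋-≼ = λ x → ∋-≼ q (∋-≼ p x) }

add : (w : World) (C : Sent) → (∀ {α} → α ∈ kF C → In (op w) α) → World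
add w C h = record
  { op = op w
  ; nice = nice w
  ; seq = C ∷ seq w
  ; controlled = λ where
      (here refl) → h
      (there m) → controlled w m
  }

≼-add : ∀ {w C} {h : ∀ {α} → α ∈ kF C → In (op w) α} → w ≼ add w C h
≼-add = record { In-≼ = λ x → x ; ∋-≼ = λ (via C m q) → via C (there m) q }

relativise : World → OT → World
relativise w γ = record
  { op = op w [[ γ ]]
  ; nice = Nice-[[]] (nice w) γ
  ; seq = seq w
  ; controlled = λ m p → In-[[]] (nice w) γ (controlled w m p)
  }

≼-relativise : ∀ {w γ} → w ≼ relativise w γ
≼-relativise {w} {γ} = record { In-≼ = In-[[]] (nice w) γ ; ∋-≼ = λ (via C m q) → via C m q }

-- The indices chosen for ∨ and ∃ are numerals; `infinite` gives the condition of `⋁R` that they lie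
-- below the height.
record Height (w : World) (α : OT) : Set where
  constructor height
  field
    inside   : In (op w) α
    infinite : ∀ k → nat k ≺ α

open Height

record Level (w : World) (γ : OT) : Set where
  constructor level
  field
    inside : In (op w) γ
    bounded : γ ⪯ Ω

lev-height : ∀ {w γ} s n → Level w γ → Height w (lev s γ n)
lev-height {w} {γ} s n (level i@(t , _) c) =
  height (In-E (nice w) (lev-term s γ n t c) (E-lev s γ n) i) (λ k → nat≺lev k s γ n)

Level-≼ : ∀ {w w′ γ} → w ≼ w′ → Level w γ → Level w′ γ
Level-≼ p (level i c) = level (In-≼ p i) c

Ω-level : ∀ {w} → Level w Ω
Ω-level {w} = level (In-∅E (nice w) tt (λ ())) tt

-- Each connective counts two, since deriving its identity takes one inference for it and one for
-- its dual.
size : ∀ {P n} → Fm P n → ℕ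
size (eq _ _) = 0
size (neq _ _) = 0
size (pos _ _) = 0
size (neg _ _) = 0
size (and A B) = 2 +ℕ (size A ⊔ size B)
size (or A B) = 2 +ℕ (size A ⊔ size B)
size (all A) = 2 +ℕ size A
size (ex A) = 2 +ℕ size A

HasNeg : ∀ {P n} → Fm P n → Set
HasNeg (neg _ _) = ⊤
HasNeg (and A B) = HasNeg A ⊎ HasNeg B
HasNeg (or A B) = HasNeg A ⊎ HasNeg B
HasNeg (all A) = HasNeg A
HasNeg (ex A) = HasNeg A
HasNeg _ = ⊥

noNeg⇒¬HasNeg : ∀ {n} (A : Fm ⊤ n) → T (noNeg A) → ¬ HasNeg A
noNeg⇒¬HasNeg (and A B) p (inj₁ h) = noNeg⇒¬HasNeg A (proj₁ (∧-elim (noNeg A) p)) h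
noNeg⇒¬HasNeg (and A B) p (inj₂ h) = noNeg⇒¬HasNeg B (proj₂ (∧-elim (noNeg A) p)) h
noNeg⇒¬HasNeg (or A B) p (inj₁ h) = noNeg⇒¬HasNeg A (proj₁ (∧-elim (noNeg A) p)) h
noNeg⇒¬HasNeg (or A B) p (inj₂ h) = noNeg⇒¬HasNeg B (proj₂ (∧-elim (noNeg A) p)) h
noNeg⇒¬HasNeg (all A) p h = noNeg⇒¬HasNeg A p h
noNeg⇒¬HasNeg (ex A) p h = noNeg⇒¬HasNeg A p h

two-cases : ∀ A B γ → two A B γ ≡ A ⊎ two A B γ ≡ B
two-cases A B Ω = inj₂ refl
two-cases A B (ϑ _) = inj₂ refl
two-cases A B ⟨ [] ⟩ = inj₁ refl
two-cases A B ⟨ _ ∷ _ ⟩ = inj₂ refl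

-- As `literal` keeps predicates atomic, `sentT` sends each connective to its own tree constructor,
-- so `≈` determines the outer form of the sentence. The other inversions hold for the same reason.
eq-inv : ∀ C {m n} → sentT C ≈ eqT m n →
         Σ (Tm 0) λ s → Σ (Tm 0) λ t → C ≡ eq s t × ⟦ s ⟧ ≡ m × ⟦ t ⟧ ≡ n
eq-inv (eq s t) eq≈ = s , t , refl , sym (ev-closed ε s) , sym (ev-closed ε t)

neq-inv : ∀ C {m n} → sentT C ≈ neqT m n →
          Σ (Tm 0) λ s → Σ (Tm 0) λ t → C ≡ neq s t × ⟦ s ⟧ ≡ m × ⟦ t ⟧ ≡ n
neq-inv (neq s t) neq≈ = s , t , refl , sym (ev-closed ε s) , sym (ev-closed ε t)

pos-inv : ∀ C {φ γ k} → sentT C ≈ posT φ γ k → Σ (Tm 0) λ t → C ≡ pos (φ , γ) t × ev ε t ≡ k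
pos-inv (pos (φ , γ) t) pos≈ = t , refl , refl

neg-inv : ∀ C {φ γ k} → sentT C ≈ negT φ γ k → Σ (Tm 0) λ t → C ≡ neg (φ , γ) t × ev ε t ≡ k
neg-inv (neg (φ , γ) t) neg≈ = t , refl , refl

and-inv : ∀ C {R S} → sentT C ≈ andT R S →
          Σ Sent λ A → Σ Sent λ B → C ≡ and A B × sentT A ≈ R × sentT B ≈ S
and-inv (and A B) (and≈ p q) = A , B , refl , p , q

or-inv : ∀ C {R S} → sentT C ≈ orT R S →
         Σ Sent λ A → Σ Sent λ B → C ≡ or A B × sentT A ≈ R × sentT B ≈ S
or-inv (or A B) (or≈ p q) = A , B , refl , p , q

all-inv : ∀ C {f} → sentT C ≈ allT f → Σ (Fm PΩ 1) λ A → C ≡ all A × (∀ k → tr literal A (k ◂ ε) ≈ f k)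
all-inv (all A) (all≈ p) = A , refl , p

ex-inv : ∀ C {f} → sentT C ≈ exT f → Σ (Fm PΩ 1) λ A → C ≡ ex A × (∀ k → tr literal A (k ◂ ε) ≈ f k)
ex-inv (ex A) (ex≈ p) = A , refl , p

≡ᵇ-true : ∀ {m n} → m ≡ n → (m ≡ᵇ n) ≡ true
≡ᵇ-true {m} {n} p with m ≡ᵇ n | ≡⇒≡ᵇ m n p
... | true | _ = refl

≡ᵇ-false : ∀ {m n} → ¬ (m ≡ n) → (m ≡ᵇ n) ≡ false
≡ᵇ-false {m} {n} p with m ≡ᵇ n | ≡ᵇ⇒≡ m n
... | true  | q = ⊥-elim (p (q tt))
... | false | _ = refl

idT-opInst : ∀ {n} φ (ψ : FmID (suc n)) k v →
             idT (opInst φ ψ) (k ◂ v) ≈ tr (λ _ j → idT ψ (j ◂ v)) (proj₁ φ) (λ _ → k)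
idT-opInst φ ψ k v = tr-inst _ _ (proj₁ φ) _ _ (λ _ → refl)
  (λ _ j → tr-subst _ ψ _ (ev-liftS _ (λ _ → refl) j))

-- Two for each disjunction and one for ∀ and Fix, plus `size` where an identity is derived at the
-- top level. In `ind` and `axL` the size of the formula enters only below Ω·2.
axiomHeight : ∀ {n} {A : FmID n} → Ax A → ℕ
axiomHeight (eqSub A _ _) = 4 +ℕ size A
axiomHeight (sucInj _ _) = 2
axiomHeight (ind _) = 4
axiomHeight (axF φ) = 4 +ℕ size (proj₁ φ)
axiomHeight (axL _ _) = 5
axiomHeight _ = 0

module Rules (r : OT) where

  infix 3 _⊢_
  -- A record, so that `w` can be inferred: it could not be recovered from `op w` and `seq w` alone.
  record _⊢_ (w : World) (α : OT) : Set₁ where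
    constructor ⊢_
    field
      derivation : Der (op w) α r (seq w)
  open _⊢_ public

  KOK-world : ∀ w → KOK (op w) (seq w)
  KOK-world w C m α p = proj₂ (controlled w m p)

  -- A true literal is an empty conjunction, so `⋀R` applies without premises.
  eq-true : ∀ {w α m n} → Height w α → m ≡ n → w ∋ eqT m n → w ⊢ α
  eq-true {w} h e (via C m q) with eq-inv C q
  ... | s , t , refl , refl , refl =
    ⊢ ⋀R (proj₁ (inside h)) (proj₂ (inside h)) (KOK-world w) (eq s t) m
      (cong (λ b → if b then conj else disj) (≡ᵇ-true e)) (λ γ _ p → ⊥-elim (⊀𝟎 γ p))

  neq-true : ∀ {w α m n} → Height w α → ¬ (m ≡ n) → w ∋ neqT m n → w ⊢ α
  neq-true {w} h e (via C m q) with neq-inv C q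
  ... | s , t , refl , refl , refl =
    ⊢ ⋀R (proj₁ (inside h)) (proj₂ (inside h)) (KOK-world w) (neq s t) m
      (cong (λ b → if b then disj else conj) (≡ᵇ-false e)) (λ γ _ p → ⊥-elim (⊀𝟎 γ p))

  module _ {w : World} {α : OT} (h : Height w α) where

    or-left : ∀ {R S β} → w ∋ orT R S → β ≺ α → (∀ {w′} → w ≼ w′ → w′ ∋ R → w′ ⊢ β) → w ⊢ α
    or-left (via C m q) l d with or-inv C q
    ... | A , B , refl , p , _ =
      ⊢ ⋁R (proj₁ (inside h)) (proj₂ (inside h)) (KOK-world w) (or A B) m refl
        (nat 0) tt tt (infinite h 0) (proj₂ (In-nat (nice w) 0)) _ l
        (derivation (d {add w A (λ x → controlled w m (∈-++⁺ˡ x))} ≼-add (via A (here refl) p)))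

    or-right : ∀ {R S β} → w ∋ orT R S → β ≺ α → (∀ {w′} → w ≼ w′ → w′ ∋ S → w′ ⊢ β) → w ⊢ α
    or-right (via C m q) l d with or-inv C q
    ... | A , B , refl , _ , p =
      ⊢ ⋁R (proj₁ (inside h)) (proj₂ (inside h)) (KOK-world w) (or A B) m refl
        (nat 1) tt tt (infinite h 1) (proj₂ (In-nat (nice w) 1)) _ l
        (derivation (d {add w B (λ x → controlled w m (∈-++⁺ʳ (kF A) x))} ≼-add (via B (here refl) p)))

    ex-rule : ∀ {f β} → w ∋ exT f → β ≺ α → ∀ k → (∀ {w′} → w ≼ w′ → w′ ∋ f k → w′ ⊢ β) → w ⊢ α
    ex-rule {f} (via C m q) l k d with ex-inv C q
    ... | A , refl , p =
      ⊢ ⋁R (proj₁ (inside h)) (proj₂ (inside h)) (KOK-world w) (ex A) m refl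
        (nat k) (proj₁ (In-nat (nice w) k)) (nat≺⟨⟩ k tt) (infinite h k) (proj₂ (In-nat (nice w) k)) _ l
        (derivation (d {add w (A [ numT (lenO (nat k)) ])
                         (λ x → controlled w m (subst (_ ∈_) (kF-subst A _) x))} ≼-add
          (via _ (here refl) (subst (λ j → sentT (A [ numT j ]) ≈ f k) (sym (length-replicate k))
                               (≈-trans (sentT-instance A k) (p k))))))

    and-rule : ∀ {R S β γ} → w ∋ andT R S → β ≺ α → γ ≺ α →
               (∀ {w′} → w ≼ w′ → w′ ∋ R → w′ ⊢ β) → (∀ {w′} → w ≼ w′ → w′ ∋ S → w′ ⊢ γ) → w ⊢ α
    and-rule {R} {S} {β} {γ} (via C m q) l l′ d d′ with and-inv C q
    ... | A , B , refl , p , p′ =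
      ⊢ ⋀R (proj₁ (inside h)) (proj₂ (inside h)) (KOK-world w) (and A B) m refl premise
      where
      premise : ∀ δ → IsTerm δ → δ ≺ nat 2 →
                Σ OT λ αδ → αδ ≺ α × Der (op w [[ δ ]]) αδ r (two A B δ ∷ seq w)
      premise δ _ _ with two A B δ | two-cases A B δ
      ... | _ | inj₁ refl = β , l ,
        derivation (d {add (relativise w δ) A (λ x → controlled (relativise w δ) m (∈-++⁺ˡ x))}
          (≼-trans ≼-relativise ≼-add) (via A (here refl) p))
      ... | _ | inj₂ refl = γ , l′ ,
        derivation (d′ {add (relativise w δ) B (λ x → controlled (relativise w δ) m (∈-++⁺ʳ (kF A) x))}
          (≼-trans ≼-relativise ≼-add) (via B (here refl) p′))

    -- The premises may have different heights `β k`; number induction relies on this.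
    all-rule : ∀ {f} (β : ℕ → OT) → w ∋ allT f → (∀ k → β k ≺ α) →
               (∀ k {w′} → w ≼ w′ → w′ ∋ f k → w′ ⊢ β k) → w ⊢ α
    all-rule β (via C m q) l d with all-inv C q
    ... | A , refl , p =
      ⊢ ⋀R (proj₁ (inside h)) (proj₂ (inside h)) (KOK-world w) (all A) m refl λ δ _ _ →
        β (lenO δ) , l (lenO δ) ,
        derivation (d (lenO δ) {add (relativise w δ) (A [ numT (lenO δ) ])
                     (λ x → controlled (relativise w δ) m (subst (_ ∈_) (kF-subst A _) x))}
          (≼-trans ≼-relativise ≼-add)
          (via _ (here refl) (≈-trans (sentT-instance A (lenO δ)) (p (lenO δ)))))

    pos-rule : ∀ {φ γ k β} → w ∋ posT φ γ k → β ≺ α → ∀ δ → In (op w) δ → δ ≺ γ → δ ≺ α →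
               (∀ {w′} → w ≼ w′ → w′ ∋ opT φ δ k → w′ ⊢ β) → w ⊢ α
    pos-rule {φ} {γ} (via C m q) l δ i δ≺γ δ≺α d with pos-inv C q
    ... | t , refl , refl =
      ⊢ ⋁R (proj₁ (inside h)) (proj₂ (inside h)) (KOK-world w) (pos (φ , γ) t) m refl
        δ (proj₁ i) δ≺γ δ≺α (proj₂ i) _ l
        (derivation (d {add w (opAt φ t δ) (λ x → subst (In (op w)) (sym (kF-opAt φ t δ x)) i)} ≼-add
          (via _ (here refl) (sentT-opAt φ t δ))))

    neg-rule : ∀ {φ γ k} (β : OT → OT) → w ∋ negT φ γ k → (∀ δ → δ ≺ γ → β δ ≺ α) →
               (∀ δ → δ <ᵗ γ → ∀ {w′} → w ≼ w′ → In (op w′) δ → w′ ∋ ~ opT φ δ k → w′ ⊢ β δ) → w ⊢ α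
    neg-rule {φ} {γ} β (via C m q) l d with neg-inv C q
    ... | t , refl , refl =
      ⊢ ⋀R (proj₁ (inside h)) (proj₂ (inside h)) (KOK-world w) (neg (φ , γ) t) m refl λ δ tδ δ≺γ →
        β δ , l δ δ≺γ ,
        derivation (d δ (tδ , δ≺γ)
          {add (relativise w δ) (negF (opAt φ t δ))
            (λ x → subst (In (op w [[ δ ]])) (sym (kF-opAt φ t δ (subst (_ ∈_) (kF-neg (opAt φ t δ)) x)))
                     (self-[[]] (nice w) tδ))}
          (≼-trans ≼-relativise ≼-add) (self-[[]] (nice w) tδ)
          (via _ (here refl) (≈-trans (tr-neg literal (opAt φ t δ) ε) (~-cong (sentT-opAt φ t δ)))))

    fix-rule : ∀ {φ k β} → Ω ⪯ α → w ∋ posT φ Ω k → β ≺ α →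
               (∀ {w′} → w ≼ w′ → w′ ∋ opT φ Ω k → w′ ⊢ β) → w ⊢ α
    fix-rule {φ} Ω⪯α (via C m q) l d with pos-inv C q
    ... | t , refl , refl =
      ⊢ FixR (proj₁ (inside h)) (proj₂ (inside h)) (KOK-world w) Ω⪯α φ t m _ l
        (derivation (d {add w (opAt φ t Ω)
                         (λ x → subst (In (op w)) (sym (kF-opAt φ t Ω x)) (Level.inside (Ω-level {w})))}
          ≼-add (via _ (here refl) (sentT-opAt φ t Ω))))

    cut-rule : ∀ {β} (C : Sent) → (∀ {γ} → γ ∈ kF C → γ ≡ Ω) → rk C ≺ r → β ≺ α →
               (∀ {w′} → w ≼ w′ → w′ ∋ sentT C → w′ ⊢ β) →
               (∀ {w′} → w ≼ w′ → w′ ∋ ~ sentT C → w′ ⊢ β) → w ⊢ α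
    cut-rule C k≡Ω rk≺r l d d′ =
      ⊢ CutR (proj₁ (inside h)) (proj₂ (inside h)) (KOK-world w) C
        (λ γ x → subst (λ γ → IsTerm γ × γ ⪯ Ω) (sym (k≡Ω x)) (tt , tt)) rk≺r _ l
        (derivation (d {add w C inΩ} ≼-add (via C (here refl) ≈-refl)))
        (derivation (d′ {add w (negF C) (λ x → inΩ (subst (_ ∈_) (kF-neg C) x))} ≼-add
          (via _ (here refl) (tr-neg literal C ε))))
      where
      inΩ : ∀ {γ} → γ ∈ kF C → In (op w) γ
      inΩ x = subst (In (op w)) (sym (k≡Ω x)) (Level.inside (Ω-level {w}))

  module _ {w : World} (s : Base) (γ : OT) (c : Level w γ) where

    -- `⋁R` keeps its principal formula, so the disjunction is used twice, once for each side.
    or-both : ∀ {R S n} → w ∋ orT R S → (∀ {w′} → w ≼ w′ → w′ ∋ R → w′ ∋ S → w′ ⊢ lev s γ n) →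
              w ⊢ lev s γ (2 +ℕ n)
    or-both {n = n} o d =
      or-left (lev-height s _ c) o (lev-step s γ (suc n)) λ le o₁ →
      or-right (lev-height s _ (Level-≼ le c)) (∋-≼ le o) (lev-step s γ n) λ le′ o₂ →
      d (≼-trans le le′) (∋-≼ le′ o₁) o₂

    and-or : ∀ {R S R′ S′ n} → w ∋ andT R S → w ∋ orT R′ S′ →
             (∀ {w′} → w ≼ w′ → w′ ∋ R → w′ ∋ R′ → w′ ⊢ lev s γ n) →
             (∀ {w′} → w ≼ w′ → w′ ∋ S → w′ ∋ S′ → w′ ⊢ lev s γ n) → w ⊢ lev s γ (2 +ℕ n)
    and-or {n = n} a o d d′ =
      and-rule (lev-height s _ c) a (lev-step s γ (suc n)) (lev-step s γ (suc n))
        (λ le x → or-left (lev-height s _ (Level-≼ le c)) (∋-≼ le o) (lev-step s γ n)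
          λ le′ y → d (≼-trans le le′) (∋-≼ le′ x) y)
        (λ le x → or-right (lev-height s _ (Level-≼ le c)) (∋-≼ le o) (lev-step s γ n)
          λ le′ y → d′ (≼-trans le le′) (∋-≼ le′ x) y)

    all-ex : ∀ {f g n} → w ∋ allT f → w ∋ exT g →
             (∀ k {w′} → w ≼ w′ → w′ ∋ f k → w′ ∋ g k → w′ ⊢ lev s γ n) → w ⊢ lev s γ (2 +ℕ n)
    all-ex {n = n} a o d =
      all-rule (lev-height s _ c) (λ _ → lev s γ (suc n)) a (λ _ → lev-step s γ (suc n)) λ k le x →
      ex-rule (lev-height s _ (Level-≼ le c)) (∋-≼ le o) (lev-step s γ n) k λ le′ y →
      d k (≼-trans le le′) (∋-≼ le′ x) y

  -- Identities and generalised induction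

  excluded-middle : ∀ {w α m n} → Height w α → w ∋ eqT m n → w ∋ neqT m n → w ⊢ α
  excluded-middle {m = m} {n} h x y with m ≟ n
  ... | yes e = eq-true h e x
  ... | no ne = neq-true h ne y

  -- With F = G this is the identity A , ¬ A; with a positive A and I^{≺δ}, ψ for F, G it is the
  -- step φ(t, I^{≺δ}) → φ(t, ψ) of generalised induction.
  monotone : ∀ {P j} (F G : P → ℕ → Tree) s γ (A : Fm P j) {v n w} → size A ≤ n → Level w γ →
    (∀ p k {w′} → w ≼ w′ → w′ ∋ ~ F p k → w′ ∋ G p k → ∀ n → w′ ⊢ lev s γ n) →
    (HasNeg A → ∀ p k {w′} → w ≼ w′ → w′ ∋ ~ (~ F p k) → w′ ∋ ~ G p k → ∀ n → w′ ⊢ lev s γ n) →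
    w ∋ ~ tr F A v → w ∋ tr G A v → w ⊢ lev s γ n
  monotone F G s γ (eq _ _) _ c f g x y = excluded-middle (lev-height s _ c) y x
  monotone F G s γ (neq _ _) _ c f g x y = excluded-middle (lev-height s _ c) x y
  monotone F G s γ (pos p t) _ c f g x y = f p _ ≼-refl x y _
  monotone F G s γ (neg p t) _ c f g x y = g tt p _ ≼-refl x y _
  monotone F G s γ (and A B) (s≤s (s≤s b)) c f g x y = and-or s γ c y x
    (λ le y′ x′ → monotone F G s γ A (m⊔n≤o⇒m≤o _ _ b) (Level-≼ le c)
      (λ p k le′ → f p k (≼-trans le le′)) (λ h p k le′ → g (inj₁ h) p k (≼-trans le le′)) x′ y′)
    (λ le y′ x′ → monotone F G s γ B (m⊔n≤o⇒n≤o (size A) _ b) (Level-≼ le c)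
      (λ p k le′ → f p k (≼-trans le le′)) (λ h p k le′ → g (inj₂ h) p k (≼-trans le le′)) x′ y′)
  monotone F G s γ (or A B) (s≤s (s≤s b)) c f g x y = and-or s γ c x y
    (λ le x′ y′ → monotone F G s γ A (m⊔n≤o⇒m≤o _ _ b) (Level-≼ le c)
      (λ p k le′ → f p k (≼-trans le le′)) (λ h p k le′ → g (inj₁ h) p k (≼-trans le le′)) x′ y′)
    (λ le x′ y′ → monotone F G s γ B (m⊔n≤o⇒n≤o (size A) _ b) (Level-≼ le c)
      (λ p k le′ → f p k (≼-trans le le′)) (λ h p k le′ → g (inj₂ h) p k (≼-trans le le′)) x′ y′)
  monotone F G s γ (all A) (s≤s (s≤s b)) c f g x y = all-ex s γ c y x
    (λ _ le y′ x′ → monotone F G s γ A b (Level-≼ le c)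
      (λ p k le′ → f p k (≼-trans le le′)) (λ h p k le′ → g h p k (≼-trans le le′)) x′ y′)
  monotone F G s γ (ex A) (s≤s (s≤s b)) c f g x y = all-ex s γ c x y
    (λ _ le x′ y′ → monotone F G s γ A b (Level-≼ le c)
      (λ p k le′ → f p k (≼-trans le le′)) (λ h p k le′ → g h p k (≼-trans le le′)) x′ y′)

  -- Induction on γ. For each δ ≺ γ the conjunction ¬ I^{≺γ} yields ¬ φ(k, I^{≺δ}), and the
  -- disjunction I^{≺γ} is then taken at the same δ. The two meet by `monotone`, whose atoms I^{≺δ}
  -- fall to the induction hypothesis.
  atom-identity : ∀ s γ → Acc _<ᵗ_ γ → ∀ {w φ k} → Level w γ →
                  w ∋ posT φ γ k → w ∋ negT φ γ k → ∀ n → w ⊢ lev s γ n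
  atom-identity s γ (acc rs) {φ = φ} c x y n =
    neg-rule (lev-height s n c) (λ δ → lev s δ (suc (size (proj₁ φ)))) y
      (λ δ p → lev-mono s δ γ _ n p) λ δ δ<γ le i y′ →
    let δ≺Ω = ≺⪯Ω-trans δ γ (proj₂ δ<γ) (Level.bounded c)
        cδ  = level i (≺⇒⪯ δ Ω δ≺Ω)
    in
    pos-rule (lev-height s _ cδ) (∋-≼ le x) (lev-step s δ _) δ i (proj₂ δ<γ) (≺lev s δ _ δ≺Ω) λ le′ x′ →
    monotone _ _ s δ (proj₁ φ) ≤-refl (Level-≼ le′ cδ)
      (λ _ k le″ u v → atom-identity s δ (rs δ<γ) (Level-≼ (≼-trans le′ le″) cδ) v u)
      (λ h → ⊥-elim (noNeg⇒¬HasNeg (proj₁ φ) (proj₂ φ) h))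
      (∋-≼ le′ y′) x′

  -- The map `f` covers both formulas of ID_1, where it is the identity, and φ(x, I_φ), where it is
  -- constantly φ.
  identity : ∀ {P j} (f : P → OpForm) s (A : Fm P j) {v w n} → size A ≤ n →
             w ∋ ~ tr (λ p → posT (f p) Ω) A v → w ∋ tr (λ p → posT (f p) Ω) A v → w ⊢ lev s Ω n
  identity f s A b x y = monotone _ _ s Ω A b Ω-level
    (λ p k le u v → atom-identity s Ω accΩ Ω-level v u)
    (λ _ p k le u v → atom-identity s Ω accΩ Ω-level u v) x y
    where accΩ = <ᵗ-accessible Ω tt

  module _ (φ : OpForm) (Q : ℕ → Tree) (d : ℕ)
    (Q-identity : ∀ {w} k → w ∋ ~ Q k → w ∋ Q k → w ⊢ lev 0Ω Ω d) where

    -- This is the negation of progressiveness of `Q`, the form in which the hypothesis occurs in a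
    -- sequent.
    Prog : Tree
    Prog = exT (λ k → andT (tr (λ _ → Q) (proj₁ φ) (λ _ → k)) (~ Q k))

    -- For δ ≺ γ the sequent gains ¬ φ(k, I^{≺δ}). Instantiating `Prog` at `k` leaves φ(k, Q),
    -- obtained by `monotone` with the induction hypothesis for the atoms, and ¬ Q k, which meets Q
    -- k at height Ω + 1 + d, below every `lev 1Ω δ`.
    generalised-induction : ∀ γ → Acc _<ᵗ_ γ → ∀ {w k} → Level w γ →
      w ∋ Prog → w ∋ negT φ γ k → w ∋ Q k → ∀ n → w ⊢ lev 1Ω γ n
    generalised-induction γ (acc rs) {k = k} c prog x q n =
      neg-rule (lev-height 1Ω n c) (λ δ → lev 1Ω δ (2 +ℕ size (proj₁ φ))) x
        (λ δ p → lev-mono 1Ω δ γ _ n p) λ δ δ<γ le i x′ →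
      let cδ = level i (≺⇒⪯ δ Ω (≺⪯Ω-trans δ γ (proj₂ δ<γ) (Level.bounded c))) in
      ex-rule (lev-height 1Ω _ cδ) (∋-≼ le prog) (lev-step 1Ω δ _) k λ le₁ a →
      and-rule (lev-height 1Ω _ (Level-≼ le₁ cδ)) a (lev-step 1Ω δ _) (levΩ≺lev d δ _)
        (λ le₂ y → let le₁₂ = ≼-trans le₁ le₂ in
          monotone _ _ 1Ω δ (proj₁ φ) ≤-refl (Level-≼ le₁₂ cδ)
            (λ _ j le₃ u v → let le₀₋₃ = ≼-trans le (≼-trans le₁₂ le₃) in
              generalised-induction δ (rs δ<γ) (Level-≼ (≼-trans le₁₂ le₃) cδ) (∋-≼ le₀₋₃ prog) u v)
            (λ h → ⊥-elim (noNeg⇒¬HasNeg (proj₁ φ) (proj₂ φ) h))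
            (∋-≼ le₁₂ x′) y)
        (λ le₂ y → Q-identity k y (∋-≼ (≼-trans le (≼-trans le₁ le₂)) q))

  -- Derivations of the axioms

  module _ {n} (A : FmID (suc n)) (v : Env n) where

    -- For the goal A(k+1), the step is instantiated at k: its part A(k) is the recursive goal, and
    -- its part ¬ A(k+1) meets the goal. This takes two inferences per number.
    number-induction : ∀ k {w i} → k *ℕ 2 +ℕ size A ≤ i → w ∋ ~ idT A (0 ◂ v) →
      w ∋ exT (λ k → andT (idT A (k ◂ v)) (~ idT A (suc k ◂ v))) → w ∋ idT A (k ◂ v) → w ⊢ lev 0Ω Ω i
    number-induction zero b x step y = identity (λ φ → φ) 0Ω A b x y
    number-induction (suc k) (s≤s (s≤s b)) x step y =
      ex-rule (lev-height 0Ω _ Ω-level) step (lev-step 0Ω Ω _) k λ le a →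
      and-rule (lev-height 0Ω _ Ω-level) a (lev-step 0Ω Ω _) (lev-step 0Ω Ω _)
        (λ le′ z → number-induction k b (∋-≼ (≼-trans le le′) x) (∋-≼ (≼-trans le le′) step) z)
        (λ le′ z → identity (λ φ → φ) 0Ω A (≤-trans (m≤n+m _ (k *ℕ 2)) b) z (∋-≼ (≼-trans le le′) y))

  -- If the values of `s` and `t` differ, the literal s ≠ t is true; otherwise A(s) and A(t) have
  -- equivalent trees and an identity applies.
  equality : ∀ {n} (A : FmID (suc n)) s t v {w k} → size A ≤ k → w ∋ neqT (ev v s) (ev v t) →
             w ∋ idT (negF (A [ s ])) v → w ∋ idT (A [ t ]) v → w ⊢ lev 1Ω Ω k
  equality A s t v b x y z with ev v s ≟ ev v t
  ... | no ne = neq-true (lev-height 1Ω _ Ω-level) ne x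
  ... | yes e = identity (λ φ → φ) 1Ω A {v = ev v t ◂ v} b
    (∋-≈ (≈-trans (tr-neg _ (A [ s ]) v) (~-cong (tr-subst _ A _ (ev-sg v s e)))) y)
    (∋-≈ (tr-subst _ A _ (ev-sg v t refl)) z)

  suc-injectivity : ∀ {w k l m} → w ∋ neqT (suc l) (suc m) → w ∋ eqT l m → w ⊢ lev 1Ω Ω k
  suc-injectivity {l = l} {m} x y with l ≟ m
  ... | yes e = eq-true (lev-height 1Ω _ Ω-level) e y
  ... | no ne = neq-true (lev-height 1Ω _ Ω-level) (λ e → ne (suc-injective e)) x

  axiom : ∀ {n} {A : FmID n} (a : Ax A) {k} → axiomHeight a ≤ k → ∀ v {w} → w ∋ idT A v → w ⊢ lev 1Ω Ω k
  axiom (eqRefl t) _ v x = eq-true (lev-height 1Ω _ Ω-level) refl x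
  axiom (eqSub A s t) (s≤s (s≤s (s≤s (s≤s b)))) v x =
    or-both 1Ω Ω Ω-level x λ le y z →
    or-both 1Ω Ω Ω-level z λ le′ p q → equality A s t v b (∋-≼ le′ y) p q
  axiom (sucNz t) _ v x = neq-true (lev-height 1Ω _ Ω-level) (λ ()) x
  axiom (sucInj s t) (s≤s (s≤s _)) v x = or-both 1Ω Ω Ω-level x λ le → suc-injectivity
  axiom (add0 s) _ v x = eq-true (lev-height 1Ω _ Ω-level) (+-identityʳ _) x
  axiom (addS s t) _ v x = eq-true (lev-height 1Ω _ Ω-level) (+-suc (ev v s) (ev v t)) x
  axiom (mul0 s) _ v x = eq-true (lev-height 1Ω _ Ω-level) (*-zeroʳ (ev v s)) x
  axiom (mulS s t) _ v x = eq-true (lev-height 1Ω _ Ω-level)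
    (trans (*-suc (ev v s) (ev v t)) (+-comm (ev v s) (ev v s *ℕ ev v t))) x
  axiom (ind A) (s≤s (s≤s (s≤s (s≤s b)))) v x =
    or-both 1Ω Ω Ω-level x λ le base x′ →
    or-both 1Ω Ω Ω-level x′ λ le′ step goal →
    -- These heights are unbounded in `k` but stay below Ω·2.
    all-rule (lev-height 1Ω _ Ω-level) (λ k → lev 0Ω Ω (k *ℕ 2 +ℕ size A)) goal
      (λ k → levΩ≺lev _ Ω _) λ k le″ y →
    number-induction A v k ≤-refl
      (∋-≼ (≼-trans le′ le″)
        (∋-≈ (≈-trans (tr-neg _ (A [ zer ]) v) (~-cong (tr-subst _ A _ (ev-sg v zer refl)))) base))
      (∋-≼ le″ (∋-≈ (ex≈ λ j → and≈ ≈-refl (≈-trans (tr-neg _ (substF _ A) _)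
        (~-cong (tr-subst _ A _ λ { fz → refl ; (fs i) → refl })))) step))
      y
  axiom (axF φ) (s≤s (s≤s (s≤s (s≤s b)))) v x =
    all-rule (lev-height 1Ω _ Ω-level) (λ _ → lev 1Ω Ω _) x (λ _ → lev-step 1Ω Ω _) λ k le y →
    or-both 1Ω Ω Ω-level y λ le′ p q →
    -- Fix turns I_φ k into φ(k, I_φ), which is dual to the other disjunct `p`.
    fix-rule (lev-height 1Ω _ Ω-level) (Ω⪯lev _) q (lev-step 1Ω Ω _) λ le″ r →
    identity (λ _ → φ) 1Ω (proj₁ φ) b
      (∋-≼ le″ (∋-≈ (≈-trans (tr-neg _ (opInst φ (pos φ (var fz))) _)
        (~-cong (idT-opInst φ (pos φ (var fz)) k v))) p)) r
  axiom (axL φ ψ) (s≤s (s≤s (s≤s (s≤s (s≤s b))))) v x =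
    or-both 1Ω Ω Ω-level x λ le prog x′ →
    all-rule (lev-height 1Ω _ Ω-level) (λ _ → lev 1Ω Ω _) x′ (λ _ → lev-step 1Ω Ω _) λ k le′ y →
    or-both 1Ω Ω Ω-level y λ le″ p q →
    -- At γ = Ω the exponent `e Ω` is Ω, which gives the height Ω·2 + 1 + n.
    generalised-induction φ (λ j → idT ψ (j ◂ v)) (size ψ)
      (λ j → identity (λ φ → φ) 0Ω ψ ≤-refl) Ω (<ᵗ-accessible Ω tt) Ω-level
      -- The negated hypothesis of (L) is ∃x(¬¬φ(x, ψ) ∧ ¬ψ(x)); removing the double negation turns
      -- it into `Prog`.
      (∋-≼ (≼-trans le′ le″) (∋-≈ (ex≈ λ j → and≈
        (≈-trans (tr-neg _ (negF (opInst φ ψ)) _) (≈-trans (~-cong (tr-neg _ (opInst φ ψ) _))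
          (≈-trans (~-invol _) (idT-opInst φ ψ j v))))
        (tr-neg _ ψ _)) prog)) p q _

-- Ranks of cut formulas

data SmallRank (i : ℕ) : OT → Set where
  finite : ∀ {j} → j ≤ i → SmallRank i (nat j)
  Ω+     : ∀ {j} → j ≤ i → SmallRank i (Ω +O nat j)

keep-𝟎 : ∀ as → keep 𝟎 as ≡ as
keep-𝟎 [] = refl
keep-𝟎 (a ∷ as) with keep 𝟎 as | keep-𝟎 as
... | [] | refl with le 𝟎 a | 𝟎⪯ a
... | true | _ = refl
keep-𝟎 (a ∷ as) | _ ∷ _ | refl = refl

zeros-snoc : ∀ n → replicate n 𝟎 ++ 𝟎 ∷ [] ≡ replicate (suc n) 𝟎
zeros-snoc zero = refl
zeros-snoc (suc n) = cong (𝟎 ∷_) (zeros-snoc n)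

+1-nat : ∀ j → nat j +O nat 1 ≡ nat (suc j)
+1-nat j = cong fromL (trans (cong (_++ 𝟎 ∷ []) (keep-𝟎 (replicate j 𝟎))) (zeros-snoc j))

+1-Ω : ∀ j → (Ω +O nat j) +O nat 1 ≡ Ω +O nat (suc j)
+1-Ω zero = refl
+1-Ω (suc j) = cong fromL (trans (cong (_++ 𝟎 ∷ []) (keep-𝟎 (Ω ∷ replicate (suc j) 𝟎)))
                                 (cong (Ω ∷_) (zeros-snoc (suc j))))

SmallRank-suc : ∀ {i a} → SmallRank i a → SmallRank (2 +ℕ i) (a +O nat 1)
SmallRank-suc (finite {j} p) = subst (SmallRank _) (sym (+1-nat j)) (finite (s≤s (≤-trans p (n≤1+n _))))
SmallRank-suc (Ω+ {j} p) = subst (SmallRank _) (sym (+1-Ω j)) (Ω+ (s≤s (≤-trans p (n≤1+n _))))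

SmallRank-max : ∀ {i a b} → SmallRank i a → SmallRank i b → SmallRank i (maxO a b)
SmallRank-max {a = a} {b} p q with lt a b
... | true = q
... | false = p

-- Literals have rank 0 or Ω, and maximum and successor stay among the terms j and Ω + j. The
-- substitution `σ` is present for the numerals that close a cut formula.
rk-small : ∀ {n m i} (A : FmID n) (σ : Fin n → Tm m) → size A ≤ i → SmallRank i (rk ((substF σ A) ⁺))
rk-small (eq _ _) σ b = finite z≤n
rk-small (neq _ _) σ b = finite z≤n
rk-small (pos _ _) σ b = Ω+ z≤n
rk-small (neg _ _) σ b = Ω+ z≤n
rk-small (and A B) σ (s≤s (s≤s b)) = SmallRank-suc
  (SmallRank-max (rk-small A σ (m⊔n≤o⇒m≤o _ _ b)) (rk-small B σ (m⊔n≤o⇒n≤o (size A) _ b)))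
rk-small (or A B) σ (s≤s (s≤s b)) = SmallRank-suc
  (SmallRank-max (rk-small A σ (m⊔n≤o⇒m≤o _ _ b)) (rk-small B σ (m⊔n≤o⇒n≤o (size A) _ b)))
rk-small (all A) σ (s≤s (s≤s b)) = SmallRank-suc (rk-small A (liftS σ) b)
rk-small (ex A) σ (s≤s (s≤s b)) = SmallRank-suc (rk-small A (liftS σ) b)

SmallRank⇒≺ : ∀ {i a} → SmallRank i a → a ≺ (Ω +O nat (suc i))
SmallRank⇒≺ (finite {j} p) = nat≺⟨⟩ j tt
SmallRank⇒≺ (Ω+ {zero} p) = tt
SmallRank⇒≺ (Ω+ {suc j} p) = zeros-mono p

-- Translation of finite proofs

Embedded : ∀ {n} → List (FmID n) → ℕ → ℕ → Set₁
Embedded Γ M N = ∀ {m k} → M ≤ m → N ≤ k → ∀ v {w} → (∀ {A} → A ∈ Γ → w ∋ idT A v) →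
  Rules._⊢_ (Ω +O nat (suc m)) w (lev 1Ω Ω k)

∷-env : ∀ {n Γ A w} {v : Env n} → w ∋ idT A v → (∀ {B} → B ∈ Γ → w ∋ idT B v) →
        ∀ {B} → B ∈ A ∷ Γ → w ∋ idT B v
∷-env x h (here refl) = x
∷-env x h (there m) = h m

wk-env : ∀ {n Γ w k} {v : Env n} → (∀ {B} → B ∈ Γ → w ∋ idT B v) →
         ∀ {B} → B ∈ map wk Γ → w ∋ idT B (k ◂ v)
wk-env h x with ∈-map⁻ wk x
... | B , y , refl = ∋-≈ (≈-sym (tr-subst _ B _ (λ _ → refl))) (h y)

-- The bounds hold for all larger `m` and `k`, so premises with different bounds are joined by
-- maxima. They do not depend on the assignment `v`, so the infinitely many premises of ∀ share one
-- height.
embed : ∀ {n Γ} → IDProof n Γ → Σ ℕ λ M → Σ ℕ λ N → Embedded Γ M N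
embed (axLog A _ m m′) = 0 , size A , λ _ b v h →
  Rules.identity _ (λ φ → φ) 1Ω A b (∋-≈ (tr-neg _ A v) (h m′)) (h m)
embed (axNL A a m) = 0 , axiomHeight a , λ _ b v h → Rules.axiom _ a b v (h m)
embed (andI A B m p q) with embed p | embed q
... | M , N , d | M′ , N′ , d′ = M ⊔ M′ , suc (N ⊔ N′) , λ where
  a (s≤s b) v h → Rules.and-rule _ (lev-height 1Ω _ Ω-level) (h m) (lev-step 1Ω Ω _) (lev-step 1Ω Ω _)
    (λ le x → d (m⊔n≤o⇒m≤o _ _ a) (m⊔n≤o⇒m≤o _ _ b) v (∷-env x (λ y → ∋-≼ le (h y))))
    (λ le x → d′ (m⊔n≤o⇒n≤o M _ a) (m⊔n≤o⇒n≤o N _ b) v (∷-env x (λ y → ∋-≼ le (h y))))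
embed (orI A B m p) with embed p
... | M , N , d = M , 2 +ℕ N , λ where
  a (s≤s (s≤s b)) v h → Rules.or-both _ 1Ω Ω Ω-level (h m)
    λ le x y → d a b v (∷-env x (∷-env y (λ z → ∋-≼ le (h z))))
embed (allI A m p) with embed p
... | M , N , d = M , suc N , λ where
  a (s≤s b) v h → Rules.all-rule _ (lev-height 1Ω _ Ω-level) (λ _ → lev 1Ω Ω _) (h m) (λ _ → lev-step 1Ω Ω _)
    λ k le x → d a b (k ◂ v) (∷-env x (wk-env (λ y → ∋-≼ le (h y))))
embed (exI A m t p) with embed p
... | M , N , d = M , suc N , λ where
  a (s≤s b) v h → Rules.ex-rule _ (lev-height 1Ω _ Ω-level) (h m) (lev-step 1Ω Ω _) (ev v t)
    λ le x → d a b v (∷-env (∋-≈ (≈-sym (tr-subst _ A _ (ev-sg v t refl))) x) (λ y → ∋-≼ le (h y)))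
embed (cut C p q) with embed p | embed q
... | M , N , d | M′ , N′ , d′ = size C ⊔ (M ⊔ M′) , suc (N ⊔ N′) , λ where
  a (s≤s b) v h →
    -- A cut formula has to be a sentence, so its free variables are replaced by the numerals of
    -- their values.
    let σ  = λ i → numT (v i)
        C′ = substF σ C
        C≈ : sentT (C′ ⁺) ≈ idT C v
        C≈ = ≈-trans (tr-mapP _ _ C′ ε) (tr-subst _ C σ (λ i → ev-numT ε (v i)))
        a′ = m⊔n≤o⇒n≤o (size C) _ a
    in
    Rules.cut-rule _ (lev-height 1Ω _ Ω-level) (C′ ⁺) (kF-⁺ C′)
      (SmallRank⇒≺ (rk-small C σ (m⊔n≤o⇒m≤o _ _ a))) (lev-step 1Ω Ω _)
      (λ le x → d (m⊔n≤o⇒m≤o _ _ a′) (m⊔n≤o⇒m≤o _ _ b) v (∷-env (∋-≈ C≈ x) (λ y → ∋-≼ le (h y))))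
      (λ le x → d′ (m⊔n≤o⇒n≤o M _ a′) (m⊔n≤o⇒n≤o N _ b) v
        (∷-env (∋-≈ (≈-trans (~-cong C≈) (≈-sym (tr-neg _ C v))) x) (λ y → ∋-≼ le (h y))))

theorem6p5 : (ψ : FmID 0) → ID₁⊢ ψ → (H : Op) → Nice H →
    Σ ℕ (λ m → Σ ℕ (λ n → Der H ((Ω +O Ω) +O nat n) (Ω +O nat m) ((ψ ⁺) ∷ [])))
theorem6p5 ψ p H N with embed p
-- The successors come from the cut bound Ω + (1 + M) in `Embedded` and from the 1 + K zeros at the
-- end of `lev 1Ω Ω K`.
... | M , K , d = suc M , suc K , subst (λ α → Der H α (Ω +O nat (suc M)) (ψ ⁺ ∷ [])) (lev-Ω K)
  (Rules.derivation (d ≤-refl ≤-refl ε {w} (λ { (here refl) → via (ψ ⁺) (here refl) (tr-mapP _ _ ψ ε) })))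
  where
  w : World
  w = record
    { op = H
    ; nice = N
    ; seq = ψ ⁺ ∷ []
    ; controlled = λ where
        (here refl) x → subst (In H) (sym (kF-⁺ ψ x)) (In-∅E N tt (λ ()))
    }
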